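{- Let $T \in T(n,\Delta)$ be a tree containing a vertex $\rho$ of degree $\Delta$. If there is a vertex of $T$, different from $\rho$, whose degree is at least three, then there exists a tree $T' \in T(n,\Delta)$ such that \[ e^{HM_1(T)} > e^{HM_1(T')} \quad\text{and}\quad e^{HM_2(T)} > e^{HM_2(T')}. \]
   Context: All graphs are finite and simple. $T(n,\Delta)$ denotes the collection of all trees with $n$ vertices and maximum degree (exactly) $\Delta$. For a graph $G$ with edge set $E(G)$, where $\deg(v)$ denotes the degree of the vertex $v$ in $G$, the first and second hyper-Zagreb indices are \[ HM_1(G) = \sum_{\{u,v\}\in E(G)} \left(\deg(u)+\deg(v)\right)^2, \qquad HM_2(G) = \sum_{\{u,v\}\in E(G)} \left(\deg(u)\cdot\deg(v)\right)^2 . \] The exponential forms $e^{HM_1(G)}$ and $e^{HM_2(G)}$ are the real exponential function evaluated at these numbers. -}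

module Defs where

open import Data.Fin.Base as Fin using (Fin)
import Data.Fin.Properties as Fin
open import Data.Integer.Base as ℤ using (+_; +[1+_]; -[1+_])
import Data.Integer.Properties as ℤ
open import Data.List.Base
  using (List; []; _∷_; _++_; [_]; length; map; filter; allFin; cartesianProduct)
open import Data.List.Relation.Unary.Linked using (Linked)
open import Data.List.Relation.Unary.Unique.Propositional using (Unique)
open import Data.Nat.Base as ℕ using (ℕ; zero; suc)
open import Data.Nat.ListAction using (sum)
import Data.Nat.Properties as ℕ
open import Data.Product.Base using (∃-syntax; _×_; _,_)
open import Data.Rational
  using ( ℚ; mkℚ; ↥_; 0ℚ; 1ℚ; ½; _/_; _+_; _*_; _-_; ∣_∣; _≤_; _<_; *≤*; *<*
        ; toℚᵘ; nonNegative)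
import Data.Rational.Properties as ℚ
open import Data.Rational.Solver using (module +-*-Solver)
import Data.Rational.Unnormalised as ℚᵘ
import Data.Rational.Unnormalised.Properties as ℚᵘ
open import Level using (0ℓ)
open import Relation.Binary.Construct.Closure.ReflexiveTransitive using (Star)
open import Relation.Binary.Core using (Rel)
open import Relation.Binary.Definitions using (Decidable; Irreflexive; Symmetric)
open import Relation.Binary.PropositionalEquality
  using (_≡_; refl; sym; trans; cong; cong₂; subst)
open import Relation.Nullary using (¬_)
open import Relation.Nullary.Decidable using (_×-dec_)

record Graph (n : ℕ) : Set₁ where
  infix 4 _~_ _~?_
  field
    _~_      : Rel (Fin n) 0ℓ
    _~?_     : Decidable _~_
    ~-sym    : Symmetric _~_
    ~-irrefl : Irreflexive _≡_ _~_

  degree : Fin n → ℕ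
  degree v = length (filter (v ~?_) (allFin n))

  -- Each undirected edge {i , j} is listed once, as the pair with i < j.
  edges : List (Fin n × Fin n)
  edges = filter (λ (i , j) → (i Fin.<? j) ×-dec (i ~? j))
                 (cartesianProduct (allFin n) (allFin n))

  Connected : Set
  Connected = ∀ u v → Star _~_ u v

  -- A cycle v , x₁ , … , xₖ , v through k + 1 ≥ 3 distinct vertices.
  IsCycle : Fin n → List (Fin n) → Set
  IsCycle v xs =
    2 ℕ.≤ length xs × Unique (v ∷ xs) × Linked _~_ (v ∷ xs ++ [ v ])

  Acyclic : Set
  Acyclic = ∀ v xs → ¬ IsCycle v xs

  record IsTree : Set where
    field
      nonEmpty  : Fin n
      connected : Connected
      acyclic   : Acyclic

  record MaxDegree (Δ : ℕ) : Set where
    field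
      bounded  : ∀ v → degree v ℕ.≤ Δ
      attained : ∃[ v ] degree v ≡ Δ

open Graph public using (degree; edges; IsTree; MaxDegree)

record 𝒯 (n Δ : ℕ) : Set₁ where
  field
    graph     : Graph n
    isTree    : IsTree graph
    maxDegree : MaxDegree graph Δ

open 𝒯 public using (graph)

HM₁ : ∀ {n} → Graph n → ℕ
HM₁ G = sum (map (λ (u , v) → (degree G u ℕ.+ degree G v) ℕ.^ 2) (edges G))

HM₂ : ∀ {n} → Graph n → ℕ
HM₂ G = sum (map (λ (u , v) → (degree G u ℕ.* degree G v) ℕ.^ 2) (edges G))

record ℝ : Set where
  field
    approx : ℕ → ℚ
    cauchy : ∀ ε → 0ℚ < ε →
             ∃[ N ] (∀ m n → N ℕ.≤ m → N ℕ.≤ n → ∣ approx m - approx n ∣ < ε)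

open ℝ public

infix 4 _<ℝ_ _>ℝ_

-- Terms with equal limit may stay strictly ordered, hence the fixed gap ε.
_<ℝ_ : Rel ℝ 0ℓ
x <ℝ y = ∃[ ε ] (0ℚ < ε × ∃[ N ] (∀ n → N ℕ.≤ n → approx x n + ε < approx y n))

_>ℝ_ : Rel ℝ 0ℓ
x >ℝ y = y <ℝ x

-- expTerm q i = qⁱ / i!
expTerm : ℚ → ℕ → ℚ
expTerm q zero    = 1ℚ
expTerm q (suc i) = expTerm q i * (q * (+ 1 / suc i))

-- expSum q n = Σ_{i < n} qⁱ / i!
expSum : ℚ → ℕ → ℚ
expSum q zero    = 0ℚ
expSum q (suc n) = expSum q n + expTerm q n

-- For the Cauchy property of expSum: from index 2∣↥ q∣ on, the terms at least halve at each step.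
private
  -- halve c j = c / 2ʲ
  halve : ℚ → ℕ → ℚ
  halve c zero    = c
  halve c (suc j) = halve c j * ½

  halve-double : ∀ c j → halve c (suc j) + halve c (suc j) ≡ halve c j
  halve-double c j =
    trans (sym (ℚ.*-distribˡ-+ (halve c j) ½ ½)) (ℚ.*-identityʳ (halve c j))

  halve-≥0 : ∀ c j → 0ℚ ≤ c → 0ℚ ≤ halve c j
  halve-≥0 c zero    0≤c = 0≤c
  halve-≥0 c (suc j) 0≤c = ℚ.*-monoʳ-≤-nonNeg ½ (halve-≥0 c j 0≤c)

  half-next : ∀ j → ½ * (+ suc (suc j) / 1) ≤ + suc j / 1
  half-next j = ℚ.toℚᵘ-cancel-≤ (begin
    toℚᵘ (½ * (+ suc (suc j) / 1))           ≃⟨ ℚ.toℚᵘ-homo-* ½ (+ suc (suc j) / 1) ⟩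
    toℚᵘ ½ ℚᵘ.* toℚᵘ (+ suc (suc j) / 1)
      ≃⟨ ℚᵘ.*-congˡ {toℚᵘ ½} (ℚ.toℚᵘ-fromℚᵘ (ℚᵘ.mkℚᵘ (+ suc (suc j)) 0)) ⟩
    toℚᵘ ½ ℚᵘ.* ℚᵘ.mkℚᵘ (+ suc (suc j)) 0    ≤⟨ ℚᵘ.*≤* (ℤ.+≤+ bound) ⟩
    ℚᵘ.mkℚᵘ (+ suc j) 0                      ≃⟨ ℚ.toℚᵘ-fromℚᵘ (ℚᵘ.mkℚᵘ (+ suc j) 0) ⟨
    toℚᵘ (+ suc j / 1)                       ∎)
    where
    open ℚᵘ.≤-Reasoning
    bound : (1 ℕ.* suc (suc j)) ℕ.* 1 ℕ.≤ suc j ℕ.* 2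
    bound rewrite ℕ.*-identityʳ (1 ℕ.* suc (suc j)) | ℕ.*-identityˡ (suc (suc j)) =
      ℕ.s≤s (ℕ.s≤s (ℕ.m≤m*n j 2))

  halve-* : ∀ c j → 0ℚ ≤ c → halve c j * (+ suc j / 1) ≤ c
  halve-* c zero    0≤c = ℚ.≤-reflexive (ℚ.*-identityʳ c)
  halve-* c (suc j) 0≤c = begin
    halve c j * ½ * (+ suc (suc j) / 1)    ≡⟨ ℚ.*-assoc (halve c j) ½ _ ⟩
    halve c j * (½ * (+ suc (suc j) / 1))
      ≤⟨ ℚ.*-monoˡ-≤-nonNeg (halve c j) {{nonNegative (halve-≥0 c j 0≤c)}} (half-next j) ⟩
    halve c j * (+ suc j / 1)              ≤⟨ halve-* c j 0≤c ⟩
    c                                      ∎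
    where open ℚ.≤-Reasoning

  archimedean : ∀ c ε → 0ℚ ≤ c → 0ℚ < ε → ∃[ j ] c < ε * (+ suc j / 1)
  archimedean c@(mkℚ -[1+ _ ] _ _) _ (*≤* ()) _
  archimedean _ ε@(mkℚ -[1+ _ ] _ _) _ (*<* ())
  archimedean _ ε@(mkℚ (+ 0) _ _) _ (*<* (ℤ.+<+ ()))
  archimedean c@(mkℚ (+ a) d _) ε@(mkℚ +[1+ p ] e _) _ _ = j , ℚ.toℚᵘ-cancel-< (begin-strict
    toℚᵘ c                             <⟨ ℚᵘ.*<* bound′ ⟩
    toℚᵘ ε ℚᵘ.* ℚᵘ.mkℚᵘ (+ suc j) 0
      ≃⟨ ℚᵘ.*-congˡ {toℚᵘ ε} (ℚ.toℚᵘ-fromℚᵘ (ℚᵘ.mkℚᵘ (+ suc j) 0)) ⟨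
    toℚᵘ ε ℚᵘ.* toℚᵘ (+ suc j / 1)     ≃⟨ ℚ.toℚᵘ-homo-* ε (+ suc j / 1) ⟨
    toℚᵘ (ε * (+ suc j / 1))           ∎)
    where
    open ℚᵘ.≤-Reasoning
    j = a ℕ.* suc e
    bound : a ℕ.* (suc e ℕ.* 1) ℕ.< (suc p ℕ.* suc j) ℕ.* suc d
    bound rewrite ℕ.*-identityʳ (suc e) =
      ℕ.<-≤-trans (ℕ.n<1+n j)
        (ℕ.≤-trans (ℕ.m≤n*m (suc j) (suc p)) (ℕ.m≤m*n (suc p ℕ.* suc j) (suc d)))
    bound′ : + a ℤ.* + (suc e ℕ.* 1) ℤ.< (+[1+ p ] ℤ.* + suc j) ℤ.* + suc d
    bound′ = subst (λ z → z ℤ.< + ((suc p ℕ.* suc j) ℕ.* suc d)) (ℤ.pos-* a (suc e ℕ.* 1)) (ℤ.+<+ bound)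

  halve-→0 : ∀ c ε → 0ℚ ≤ c → 0ℚ < ε → ∃[ j ] halve c j < ε
  halve-→0 c ε 0≤c 0<ε with j , c< ← archimedean c ε 0≤c 0<ε =
    j , ℚ.*-cancelʳ-<-nonNeg (+ suc j / 1) {{ℚ.normalize-nonNeg (suc j) 1}}
          (ℚ.≤-<-trans (halve-* c j 0≤c) c<)

  start : ℚ → ℕ
  start q = ℤ.∣ ↥ q ∣ ℕ.* 2

  ratio-≤½ : ∀ q i → start q ℕ.≤ i → ∣ q * (+ 1 / suc i) ∣ ≤ ½
  ratio-≤½ q@(mkℚ n d _) i q≤i = ℚ.toℚᵘ-cancel-≤ (begin
    toℚᵘ ∣ q * (+ 1 / suc i) ∣               ≃⟨ ℚ.toℚᵘ-homo-∣-∣ (q * (+ 1 / suc i)) ⟩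
    ℚᵘ.∣ toℚᵘ (q * (+ 1 / suc i)) ∣          ≃⟨ ℚᵘ.∣-∣-cong (ℚ.toℚᵘ-homo-* q (+ 1 / suc i)) ⟩
    ℚᵘ.∣ toℚᵘ q ℚᵘ.* toℚᵘ (+ 1 / suc i) ∣
      ≃⟨ ℚᵘ.∣-∣-cong (ℚᵘ.*-congˡ {toℚᵘ q} (ℚ.toℚᵘ-fromℚᵘ (ℚᵘ.mkℚᵘ (+ 1) i))) ⟩
    ℚᵘ.∣ toℚᵘ q ℚᵘ.* ℚᵘ.mkℚᵘ (+ 1) i ∣       ≤⟨ ℚᵘ.*≤* bound′ ⟩
    toℚᵘ ½                                   ∎)
    where
    open ℚᵘ.≤-Reasoning
    bound : ℤ.∣ n ℤ.* + 1 ∣ ℕ.* 2 ℕ.≤ 1 ℕ.* (suc d ℕ.* suc i)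
    bound rewrite ℤ.*-identityʳ n | ℕ.*-identityˡ (suc d ℕ.* suc i) =
      ℕ.≤-trans q≤i (ℕ.≤-trans (ℕ.n≤1+n i) (ℕ.m≤n*m (suc i) (suc d)))
    bound′ : + ℤ.∣ n ℤ.* + 1 ∣ ℤ.* + 2 ℤ.≤ + 1 ℤ.* + (suc d ℕ.* suc i)
    bound′ = subst (λ z → z ℤ.≤ + (1 ℕ.* (suc d ℕ.* suc i))) (ℤ.pos-* ℤ.∣ n ℤ.* + 1 ∣ 2) (ℤ.+≤+ bound)

  module _ (q : ℚ) where
    private
      M = start q
      b = halve ∣ expTerm q M ∣

    term-bound : ∀ j → ∣ expTerm q (j ℕ.+ M) ∣ ≤ b j
    term-bound zero    = ℚ.≤-refl
    term-bound (suc j) = begin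
      ∣ t * r ∣      ≡⟨ ℚ.∣p*q∣≡∣p∣*∣q∣ t r ⟩
      ∣ t ∣ * ∣ r ∣
        ≤⟨ ℚ.*-monoˡ-≤-nonNeg ∣ t ∣ {{ℚ.∣-∣-nonNeg t}} (ratio-≤½ q (j ℕ.+ M) (ℕ.m≤n+m M j)) ⟩
      ∣ t ∣ * ½      ≤⟨ ℚ.*-monoʳ-≤-nonNeg ½ (term-bound j) ⟩
      b j * ½        ∎
      where
      open ℚ.≤-Reasoning
      t = expTerm q (j ℕ.+ M)
      r = q * (+ 1 / suc (j ℕ.+ M))

    tail-bound : ∀ k j → ∣ expSum q (k ℕ.+ (j ℕ.+ M)) - expSum q (j ℕ.+ M) ∣ ≤ b j + b j
    tail-bound zero j = begin
      ∣ s - s ∣    ≡⟨ cong ∣_∣ (ℚ.+-inverseʳ s) ⟩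
      0ℚ           ≤⟨ ℚ.+-mono-≤ 0≤b 0≤b ⟩
      b j + b j    ∎
      where
      open ℚ.≤-Reasoning
      s = expSum q (j ℕ.+ M)
      0≤b = halve-≥0 ∣ expTerm q M ∣ j (ℚ.0≤∣p∣ _)
    tail-bound (suc k) j = begin
      ∣ expSum q (suc k ℕ.+ (j ℕ.+ M)) - s ∣
        ≡⟨ cong (λ i → ∣ expSum q i - s ∣) (sym (ℕ.+-suc k (j ℕ.+ M))) ⟩
      ∣ s′ - s ∣
        ≡⟨ cong ∣_∣ (rearrange s′ s t) ⟩
      ∣ (s′ - (s + t)) + t ∣
        ≤⟨ ℚ.∣p+q∣≤∣p∣+∣q∣ (s′ - (s + t)) t ⟩
      ∣ s′ - (s + t) ∣ + ∣ t ∣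
        ≤⟨ ℚ.+-mono-≤ (tail-bound k (suc j)) (term-bound j) ⟩
      (b (suc j) + b (suc j)) + b j
        ≡⟨ cong (_+ b j) (halve-double ∣ expTerm q M ∣ j) ⟩
      b j + b j
        ∎
      where
      open ℚ.≤-Reasoning
      s  = expSum q (j ℕ.+ M)
      t  = expTerm q (j ℕ.+ M)
      s′ = expSum q (k ℕ.+ (suc j ℕ.+ M))
      rearrange : ∀ x y z → x - y ≡ (x - (y + z)) + z
      rearrange = solve 3 (λ x y z → x :- y := (x :- (y :+ z)) :+ z) refl
        where open +-*-Solver

    tail-bound′ : ∀ j m → j ℕ.+ M ℕ.≤ m → ∣ expSum q m - expSum q (j ℕ.+ M) ∣ ≤ b j + b j
    tail-bound′ j m N≤m =
      subst (λ i → ∣ expSum q i - expSum q (j ℕ.+ M) ∣ ≤ b j + b j)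
            (ℕ.m∸n+n≡m N≤m) (tail-bound (m ℕ.∸ (j ℕ.+ M)) j)

    expSum-cauchy : ∀ ε → 0ℚ < ε →
      ∃[ N ] (∀ m n → N ℕ.≤ m → N ℕ.≤ n → ∣ expSum q m - expSum q n ∣ < ε)
    expSum-cauchy ε 0<ε with j , bj<ε ← halve-→0 ∣ expTerm q M ∣ ε (ℚ.0≤∣p∣ _) 0<ε =
      N , λ m n N≤m N≤n → begin-strict
        ∣ S m - S n ∣
          ≡⟨ cong ∣_∣ (rearrange (S m) (S n) (S N)) ⟩
        ∣ (S m - S N) - (S n - S N) ∣
          ≤⟨ ℚ.∣p-q∣≤∣p∣+∣q∣ (S m - S N) (S n - S N) ⟩
        ∣ S m - S N ∣ + ∣ S n - S N ∣
          ≤⟨ ℚ.+-mono-≤ (tail-bound′ (2 ℕ.+ j) m N≤m) (tail-bound′ (2 ℕ.+ j) n N≤n) ⟩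
        (b (2 ℕ.+ j) + b (2 ℕ.+ j)) + (b (2 ℕ.+ j) + b (2 ℕ.+ j))
          ≡⟨ cong₂ _+_ (halve-double c (suc j)) (halve-double c (suc j)) ⟩
        b (suc j) + b (suc j)
          ≡⟨ halve-double c j ⟩
        b j
          <⟨ bj<ε ⟩
        ε ∎
      where
      open ℚ.≤-Reasoning
      c = ∣ expTerm q M ∣
      N = (2 ℕ.+ j) ℕ.+ M
      S = expSum q
      rearrange : ∀ x y z → x - y ≡ (x - z) - (y - z)
      rearrange = solve 3 (λ x y z → x :- y := (x :- z) :- (y :- z)) refl
        where open +-*-Solver

exp : ℚ → ℝ
exp q = record { approx = expSum q ; cauchy = expSum-cauchy q }

-- The series is only ever evaluated at naturals, so e^_ takes a natural exponent.
infix 8 e^_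

e^_ : ℕ → ℝ
e^ k = exp (+ k / 1)

{-# OPTIONS --safe #-}

module Submission where

-- The broom (a star K₁,Δ with one edge prolonged to a path) minimises both indices among the connected
-- graphs with n vertices and a vertex ρ of degree Δ ≥ 3, and strictly so against graphs with a second
-- vertex of degree ≥ 3. Let F a b be (a + b)² or (a b)². Choose g with g a + g b ≤ F a b + 2c, where
-- equality holds on the edge types {1,2} and {2,2} of the tail, and let each edge uw away from ρ give
-- g (deg u) to u and g (deg w) to w, while an edge ρx gives g (deg x) to x and the rest to ρ. A vertex
-- u ≠ ρ collects deg u · g (deg u), which lies above the secant line through its values at degrees 1
-- and 2, strictly for degrees ≥ 3; summing and using Σ deg ≥ 2 (n - 1) gives the value of the broom.

open import Defs
open import Data.Bool.Base using (if_then_else_; true; false)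
open import Data.Empty using (⊥)
open import Data.Fin.Base as Fin using (Fin; zero; suc; toℕ; inject₁; fromℕ; splitAt; _↑ˡ_; _↑ʳ_)
import Data.Fin.Properties as Fin
import Data.Integer.Base as ℤ
import Data.Integer.Properties as ℤ
open import Data.List.Base
  using (List; []; _∷_; [_]; _++_; length; map; filter; allFin; tabulate; cartesianProduct)
import Data.List.Properties as List
open import Data.List.Relation.Unary.All using (All; _∷_)
open import Data.List.Relation.Unary.AllPairs using (_∷_)
open import Data.List.Relation.Unary.Linked using (Linked; _∷_)
open import Data.List.Relation.Unary.Unique.Propositional using (Unique)
open import Data.Nat.Base using (ℕ; zero; suc; _+_; _*_; _∸_; _^_; _≤_; _<_; z≤n; s≤s; s≤s⁻¹)
open import Data.Nat.ListAction using (sum)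
open import Data.Nat.ListAction.Properties using (sum-++)
open import Data.Nat.Properties
open import Data.Nat.Tactic.RingSolver using (solve-∀)
open import Data.Product.Base using (∃-syntax; Σ-syntax; _×_; _,_; proj₁; proj₂)
open import Data.Rational.Base as ℚ using (ℚ; 0ℚ; 1ℚ; _/_)
import Data.Rational.Properties as ℚ
open import Data.Rational.Solver using (module +-*-Solver)
import Data.Rational.Unnormalised.Base as ℚᵘ
import Data.Rational.Unnormalised.Properties as ℚᵘ
open import Data.Sum.Base using (_⊎_; inj₁; inj₂; [_,_]′; swap)
open import Data.Unit.Base using (tt)
open import Function.Base using (_∘_; const)
open import Relation.Binary.Construct.Closure.ReflexiveTransitive as Star using (Star; ε; _◅_)
open import Relation.Binary.Definitions using (tri<; tri≈; tri>)
open import Relation.Binary.PropositionalEquality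
  using (_≡_; _≢_; refl; sym; trans; cong; cong₂; subst; module ≡-Reasoning)
open import Relation.Nullary using (¬_; Dec; yes; no; does; contradiction)
open import Relation.Nullary.Decidable using (_×-dec_; _⊎-dec_)
open import Relation.Unary using (Pred; Decidable)
open import Algebra.Properties.Semiring.Sum +-*-semiring
  using ( sum-syntax; sum-cong-≗; ∑-distrib-+; ∑-comm; *-distribˡ-sum; *-distribʳ-sum
        ; sum-replicate-zero; sum-init-last)
  renaming (sum to ∑)

private
  variable
    n : ℕ
    P Q R : Set

-- Indicators

𝟙 : Dec P → ℕ
𝟙 d = if does d then 1 else 0

𝟙-yes : (d : Dec P) → P → 𝟙 d ≡ 1
𝟙-yes (yes _) _ = refl
𝟙-yes (no ¬p) p = contradiction p ¬p

𝟙-no : (d : Dec P) → ¬ P → 𝟙 d ≡ 0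
𝟙-no (yes p) ¬p = contradiction p ¬p
𝟙-no (no _)  _  = refl

𝟙≤1 : (d : Dec P) → 𝟙 d ≤ 1
𝟙≤1 (yes _) = ≤-refl
𝟙≤1 (no _)  = z≤n

𝟙-cong : (d : Dec P) (e : Dec Q) → (P → Q) → (Q → P) → 𝟙 d ≡ 𝟙 e
𝟙-cong (yes p) e f _ = sym (𝟙-yes e (f p))
𝟙-cong (no ¬p) e _ g = sym (𝟙-no e (¬p ∘ g))

𝟙*-mono : (d : Dec P) {x y : ℕ} → (P → x ≤ y) → 𝟙 d * x ≤ 𝟙 d * y
𝟙*-mono (yes p) x≤y = *-monoʳ-≤ 1 (x≤y p)
𝟙*-mono (no _)  _   = z≤n

𝟙-mono : (d : Dec P) (e : Dec Q) → (P → Q) → 𝟙 d ≤ 𝟙 e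
𝟙-mono (yes p) e f = ≤-reflexive (sym (𝟙-yes e (f p)))
𝟙-mono (no _)  e f = z≤n

-- Summed over all vertices, this turns disjointness into counting bounds.
𝟙-disjoint : (d : Dec P) (e : Dec Q) (f : Dec R) → (P → R) → (Q → R) → ¬ (P × Q) → 𝟙 d + 𝟙 e ≤ 𝟙 f
𝟙-disjoint (yes p) (yes q) f _ _ ¬pq = contradiction (p , q) ¬pq
𝟙-disjoint (yes p) (no ¬q) f g _ _   = 𝟙-mono (yes p) f g
𝟙-disjoint (no ¬p) e       f _ h _   = 𝟙-mono e f h

𝟙-⊎ : (d : Dec P) (e : Dec Q) → ¬ (P × Q) → 𝟙 (d ⊎-dec e) ≡ 𝟙 d + 𝟙 e
𝟙-⊎ (yes p) (yes q) ¬pq = contradiction (p , q) ¬pq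
𝟙-⊎ (yes _) (no _)  _   = refl
𝟙-⊎ (no _)  (yes _) _   = refl
𝟙-⊎ (no _)  (no _)  _   = refl

-- Finite sums

∑-mono : {f g : Fin n → ℕ} → (∀ i → f i ≤ g i) → ∑ f ≤ ∑ g
∑-mono {zero}  _   = z≤n
∑-mono {suc _} f≤g = +-mono-≤ (f≤g zero) (∑-mono (f≤g ∘ suc))

∑-const : ∀ n c → ∑ {n} (λ _ → c) ≡ n * c
∑-const zero    c = refl
∑-const (suc n) c = cong (c +_) (∑-const n c)

∑-zero : {f : Fin n → ℕ} → (∀ i → f i ≡ 0) → ∑ f ≡ 0
∑-zero {n} f≡0 = trans (sum-cong-≗ f≡0) (sum-replicate-zero n)

∑-δ : (a : Fin n) (f : Fin n → ℕ) → ∑ (λ i → 𝟙 (a Fin.≟ i) * f i) ≡ f a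
∑-δ {suc n} zero    f =
  trans (cong₂ _+_ (+-identityʳ (f zero)) (∑-zero {n} λ _ → refl)) (+-identityʳ (f zero))
∑-δ {suc n} (suc a) f =
  trans (sum-cong-≗ λ i → cong (_* f (suc i)) (𝟙-cong (suc a Fin.≟ suc i) (a Fin.≟ i) Fin.suc-injective (cong suc)))
        (∑-δ a (f ∘ suc))

∑-δ₁ : (a : Fin n) → ∑ (λ i → 𝟙 (a Fin.≟ i)) ≡ 1
∑-δ₁ a = trans (sum-cong-≗ λ i → sym (*-identityʳ (𝟙 (a Fin.≟ i)))) (∑-δ a (λ _ → 1))

∑-split : ∀ m n (f : Fin (m + n) → ℕ) →
          ∑ f ≡ ∑ (λ i → f (i Fin.↑ˡ n)) + ∑ (λ i → f (m Fin.↑ʳ i))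
∑-split zero    n f = refl
∑-split (suc m) n f =
  trans (cong (f zero +_) (∑-split m n (f ∘ suc))) (sym (+-assoc (f zero) _ _))

∑∑ : (Fin n → Fin n → ℕ) → ℕ
∑∑ {n} f = ∑[ u < n ] ∑[ v < n ] f u v

∑∑-cong : {f g : Fin n → Fin n → ℕ} → (∀ u v → f u v ≡ g u v) → ∑∑ f ≡ ∑∑ g
∑∑-cong {n} f≡g = sum-cong-≗ {n} λ u → sum-cong-≗ {n} (f≡g u)

∑∑-mono : {f g : Fin n → Fin n → ℕ} → (∀ u v → f u v ≤ g u v) → ∑∑ f ≤ ∑∑ g
∑∑-mono {n} f≤g = ∑-mono {n} λ u → ∑-mono {n} (f≤g u)

∑∑-distrib-+ : (f g : Fin n → Fin n → ℕ) → ∑∑ (λ u v → f u v + g u v) ≡ ∑∑ f + ∑∑ g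
∑∑-distrib-+ {n} f g =
  trans (sum-cong-≗ {n} λ u → ∑-distrib-+ (f u) (g u)) (∑-distrib-+ {n} (λ u → ∑ (f u)) (λ u → ∑ (g u)))

∑-𝟙≤1 : {P : Fin n → Set} (P? : ∀ i → Dec (P i)) → (∀ {i j} → P i → P j → i ≡ j) →
        ∑[ i < n ] 𝟙 (P? i) ≤ 1
∑-𝟙≤1 {n} P? unique with Fin.any? P?
... | yes (i , pi) = ≤-trans (∑-mono {n} λ j → 𝟙-mono (P? j) (i Fin.≟ j) (unique pi)) (≤-reflexive (∑-δ₁ i))
... | no none      = ≤-trans (≤-reflexive (∑-zero {n} λ j → 𝟙-no (P? j) λ pj → none (j , pj))) z≤n

∑∑-δ : (a : Fin n) → ∑∑ (λ u v → 𝟙 (a Fin.≟ u) * 𝟙 (a Fin.≟ v)) ≡ 1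
∑∑-δ {n} a = begin
  ∑[ u < n ] ∑[ v < n ] (𝟙 (a Fin.≟ u) * 𝟙 (a Fin.≟ v))
    ≡⟨ sum-cong-≗ {n} (λ u → *-distribˡ-sum (𝟙 (a Fin.≟ u)) (λ v → 𝟙 (a Fin.≟ v))) ⟨
  ∑[ u < n ] (𝟙 (a Fin.≟ u) * (∑[ v < n ] 𝟙 (a Fin.≟ v)))
    ≡⟨ ∑-δ a (λ _ → ∑[ v < n ] 𝟙 (a Fin.≟ v)) ⟩
  ∑[ v < n ] 𝟙 (a Fin.≟ v)
    ≡⟨ ∑-δ₁ a ⟩
  1 ∎
  where open ≡-Reasoning

-- List sums as finite sums

module _ {A : Set} where

  sum-filter : {P : Pred A _} (P? : Decidable P) (f : A → ℕ) (xs : List A) →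
               sum (map f (filter P? xs)) ≡ sum (map (λ x → 𝟙 (P? x) * f x) xs)
  sum-filter P? f []       = refl
  sum-filter P? f (x ∷ xs) with does (P? x)
  ... | true  = cong₂ _+_ (sym (+-identityʳ (f x))) (sum-filter P? f xs)
  ... | false = sum-filter P? f xs

  length-filter-𝟙 : {P : Pred A _} (P? : Decidable P) (xs : List A) →
                    length (filter P? xs) ≡ sum (map (𝟙 ∘ P?) xs)
  length-filter-𝟙 P? []       = refl
  length-filter-𝟙 P? (x ∷ xs) with does (P? x)
  ... | true  = cong suc (length-filter-𝟙 P? xs)
  ... | false = length-filter-𝟙 P? xs

  sum-cartesianProduct : {B : Set} (f : A × B → ℕ) (xs : List A) (ys : List B) →
    sum (map f (cartesianProduct xs ys)) ≡ sum (map (λ x → sum (map (λ y → f (x , y)) ys)) xs)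
  sum-cartesianProduct f []       ys = refl
  sum-cartesianProduct f (x ∷ xs) ys = begin
    sum (map f (map (x ,_) ys ++ cartesianProduct xs ys))
      ≡⟨ cong sum (List.map-++ f (map (x ,_) ys) _) ⟩
    sum (map f (map (x ,_) ys) ++ map f (cartesianProduct xs ys))
      ≡⟨ sum-++ (map f (map (x ,_) ys)) _ ⟩
    sum (map f (map (x ,_) ys)) + sum (map f (cartesianProduct xs ys))
      ≡⟨ cong₂ _+_ (cong sum (sym (List.map-∘ ys))) (sum-cartesianProduct f xs ys) ⟩
    sum (map (λ y → f (x , y)) ys) + _ ∎
    where open ≡-Reasoning

sum-allFin : (f : Fin n → ℕ) → sum (map f (allFin n)) ≡ ∑ f
sum-allFin f = trans (cong sum (List.map-tabulate (λ i → i) f)) (sum-tabulate f)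
  where
  sum-tabulate : ∀ {n} (f : Fin n → ℕ) → sum (tabulate f) ≡ ∑ f
  sum-tabulate {zero}  f = refl
  sum-tabulate {suc n} f = cong (f zero +_) (sum-tabulate (f ∘ suc))

-- Degrees and edge sums

-- `L` is read with the smaller vertex first, so the value may depend on the numbering of the
-- vertices unless `L` is symmetric.
edgeSum : (Fin n → Fin n → ℕ) → Graph n → ℕ
edgeSum L G = sum (map (λ (u , v) → L u v) (edges G))

module _ {n : ℕ} (G : Graph n) where
  open Graph G using (_~_; _~?_; ~-sym; ~-irrefl)

  degree≡∑ : ∀ v → degree G v ≡ ∑ (λ u → 𝟙 (v ~? u))
  degree≡∑ v = trans (length-filter-𝟙 (v ~?_) (allFin n)) (sum-allFin {n} (λ u → 𝟙 (v ~? u)))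

  edgeSum≡∑∑ : (L : Fin n → Fin n → ℕ) →
               edgeSum L G ≡ ∑∑ λ u v → 𝟙 ((u Fin.<? v) ×-dec (u ~? v)) * L u v
  edgeSum≡∑∑ L = begin
    edgeSum L G
      ≡⟨ sum-filter (λ (u , v) → (u Fin.<? v) ×-dec (u ~? v)) (λ (u , v) → L u v)
           (cartesianProduct (allFin n) (allFin n)) ⟩
    sum (map t (cartesianProduct (allFin n) (allFin n)))
      ≡⟨ sum-cartesianProduct t (allFin n) (allFin n) ⟩
    sum (map (λ u → sum (map (λ v → t (u , v)) (allFin n))) (allFin n))
      ≡⟨ sum-allFin {n} (λ u → sum (map (λ v → t (u , v)) (allFin n))) ⟩
    ∑ (λ u → sum (map (λ v → t (u , v)) (allFin n)))
      ≡⟨ sum-cong-≗ {n} (λ u → sum-allFin (λ v → t (u , v))) ⟩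
    ∑∑ (λ u v → t (u , v)) ∎
    where
    open ≡-Reasoning
    t : Fin n × Fin n → ℕ
    t (u , v) = 𝟙 ((u Fin.<? v) ×-dec (u ~? v)) * L u v

  -- Double counting: exchanging the summation variables in the second half makes the two halves
  -- range over the two orientations of each edge, that is, over all ordered adjacent pairs.
  edgeSum-symmetrise : (L : Fin n → Fin n → ℕ) →
                       edgeSum (λ u v → L u v + L v u) G ≡ ∑∑ λ u v → 𝟙 (u ~? v) * L u v
  edgeSum-symmetrise L = begin
    edgeSum (λ u v → L u v + L v u) G
      ≡⟨ edgeSum≡∑∑ (λ u v → L u v + L v u) ⟩
    ∑∑ (λ u v → a u v * (L u v + L v u))
      ≡⟨ ∑∑-cong (λ u v → *-distribˡ-+ (a u v) (L u v) (L v u)) ⟩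
    ∑∑ (λ u v → a u v * L u v + a u v * L v u)
      ≡⟨ ∑∑-distrib-+ (λ u v → a u v * L u v) (λ u v → a u v * L v u) ⟩
    ∑∑ (λ u v → a u v * L u v) + ∑∑ (λ u v → a u v * L v u)
      ≡⟨ cong (∑∑ (λ u v → a u v * L u v) +_) (∑-comm {n} {n} (λ u v → a u v * L v u)) ⟩
    ∑∑ (λ u v → a u v * L u v) + ∑∑ (λ u v → a v u * L u v)
      ≡⟨ ∑∑-distrib-+ (λ u v → a u v * L u v) (λ u v → a v u * L u v) ⟨
    ∑∑ (λ u v → a u v * L u v + a v u * L u v)
      ≡⟨ ∑∑-cong orient ⟩
    ∑∑ (λ u v → 𝟙 (u ~? v) * L u v) ∎
    where
    open ≡-Reasoning
    a : Fin n → Fin n → ℕ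
    a u v = 𝟙 ((u Fin.<? v) ×-dec (u ~? v))
    a-sum : ∀ u v → a u v + a v u ≡ 𝟙 (u ~? v)
    a-sum u v with Fin.<-cmp u v
    ... | tri< u<v _ v≮u = trans
      (cong₂ _+_ (𝟙-cong ((u Fin.<? v) ×-dec (u ~? v)) (u ~? v) proj₂ (u<v ,_))
                 (𝟙-no ((v Fin.<? u) ×-dec (v ~? u)) (v≮u ∘ proj₁)))
      (+-identityʳ _)
    ... | tri> u≮v _ v<u =
      cong₂ _+_ (𝟙-no ((u Fin.<? v) ×-dec (u ~? v)) (u≮v ∘ proj₁))
                (𝟙-cong ((v Fin.<? u) ×-dec (v ~? u)) (u ~? v) (~-sym ∘ proj₂) (λ p → v<u , ~-sym p))
    ... | tri≈ u≮v u≡v v≮u = trans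
      (cong₂ _+_ (𝟙-no ((u Fin.<? v) ×-dec (u ~? v)) (u≮v ∘ proj₁))
                 (𝟙-no ((v Fin.<? u) ×-dec (v ~? u)) (v≮u ∘ proj₁)))
      (sym (𝟙-no (u ~? v) (~-irrefl u≡v)))
    orient : ∀ u v → a u v * L u v + a v u * L u v ≡ 𝟙 (u ~? v) * L u v
    orient u v = trans (sym (*-distribʳ-+ (L u v) (a u v) (a v u))) (cong (_* L u v) (a-sum u v))

  edgeSum-mono : {L M : Fin n → Fin n → ℕ} → (∀ u v → u ~ v → L u v ≤ M u v) → edgeSum L G ≤ edgeSum M G
  edgeSum-mono {L} {M} L≤M rewrite edgeSum≡∑∑ L | edgeSum≡∑∑ M =
    ∑∑-mono λ u v → 𝟙*-mono ((u Fin.<? v) ×-dec (u ~? v)) (L≤M u v ∘ proj₂)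

edgeSum-+ : (L M : Fin n → Fin n → ℕ) (G : Graph n) →
            edgeSum (λ u v → L u v + M u v) G ≡ edgeSum L G + edgeSum M G
edgeSum-+ {n} L M G = begin
  edgeSum (λ u v → L u v + M u v) G
    ≡⟨ edgeSum≡∑∑ G (λ u v → L u v + M u v) ⟩
  ∑∑ (λ u v → a u v * (L u v + M u v))
    ≡⟨ ∑∑-cong (λ u v → *-distribˡ-+ (a u v) (L u v) (M u v)) ⟩
  ∑∑ (λ u v → a u v * L u v + a u v * M u v)
    ≡⟨ ∑∑-distrib-+ (λ u v → a u v * L u v) (λ u v → a u v * M u v) ⟩
  ∑∑ (λ u v → a u v * L u v) + ∑∑ (λ u v → a u v * M u v)
    ≡⟨ cong₂ _+_ (edgeSum≡∑∑ G L) (edgeSum≡∑∑ G M) ⟨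
  edgeSum L G + edgeSum M G ∎
  where
  open ≡-Reasoning
  open Graph G
  a : Fin n → Fin n → ℕ
  a u v = 𝟙 ((u Fin.<? v) ×-dec (u ~? v))

-- Connected graphs

least : {P : ℕ → Set} → Decidable P → ∀ {k} → P k → ∃[ m ] (P m × ∀ j → P j → m ≤ j)
least P? {k} pk with P? 0
... | yes p0 = 0 , p0 , λ _ _ → z≤n
least P? {zero}  pk | no ¬p0 = contradiction pk ¬p0
least {P} P? {suc k} pk | no ¬p0 with m , pm , m≤ ← least (P? ∘ suc) pk =
  suc m , pm , minimal
  where
  minimal : ∀ j → P j → suc m ≤ j
  minimal zero    p0 = contradiction p0 ¬p0
  minimal (suc j) pj = s≤s (m≤ j pj)

degreeSum : Graph n → ℕ
degreeSum {n} G = ∑[ v < n ] degree G v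

module _ {n : ℕ} (G : Graph n) where
  open Graph G using (_~_; _~?_; ~-sym; ~-irrefl; Connected)

  degree-1 : ∀ {u v} → u ~ v → 1 ≤ degree G u
  degree-1 {u} {v} u~v = begin
    1                        ≡⟨ ∑-δ₁ v ⟨
    ∑[ w < n ] 𝟙 (v Fin.≟ w) ≤⟨ ∑-mono {n} (λ w → 𝟙-mono (v Fin.≟ w) (u ~? w) λ { refl → u~v }) ⟩
    ∑[ w < n ] 𝟙 (u ~? w)    ≡⟨ degree≡∑ G u ⟨
    degree G u               ∎
    where open ≤-Reasoning

  degree-2 : ∀ {u v w} → u ~ v → u ~ w → v ≢ w → 2 ≤ degree G u
  degree-2 {u} {v} {w} u~v u~w v≢w = begin
    1 + 1
      ≡⟨ cong₂ _+_ (∑-δ₁ v) (∑-δ₁ w) ⟨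
    (∑[ x < n ] 𝟙 (v Fin.≟ x)) + (∑[ x < n ] 𝟙 (w Fin.≟ x))
      ≡⟨ ∑-distrib-+ {n} (λ x → 𝟙 (v Fin.≟ x)) (λ x → 𝟙 (w Fin.≟ x)) ⟨
    ∑[ x < n ] (𝟙 (v Fin.≟ x) + 𝟙 (w Fin.≟ x))
      ≤⟨ ∑-mono {n} (λ x → 𝟙-disjoint (v Fin.≟ x) (w Fin.≟ x) (u ~? x)
           (λ { refl → u~v }) (λ { refl → u~w }) λ { (refl , refl) → v≢w refl }) ⟩
    ∑[ x < n ] 𝟙 (u ~? x)
      ≡⟨ degree≡∑ G u ⟨
    degree G u ∎
    where open ≤-Reasoning

  -- A vertex and its neighbours are distinct vertices. At the hub this yields the length of the
  -- broom's tail.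
  degree<n : ∀ u → degree G u < n
  degree<n u = begin
    1 + degree G u
      ≡⟨ cong₂ _+_ (sym (∑-δ₁ u)) (degree≡∑ G u) ⟩
    (∑[ v < n ] 𝟙 (u Fin.≟ v)) + (∑[ v < n ] 𝟙 (u ~? v))
      ≡⟨ ∑-distrib-+ {n} (λ v → 𝟙 (u Fin.≟ v)) (λ v → 𝟙 (u ~? v)) ⟨
    ∑[ v < n ] (𝟙 (u Fin.≟ v) + 𝟙 (u ~? v))
      ≤⟨ ∑-mono {n} (λ v → 𝟙-disjoint (u Fin.≟ v) (u ~? v) (yes tt) _ _ λ (u≡v , u~v) → ~-irrefl u≡v u~v) ⟩
    ∑[ v < n ] 1
      ≡⟨ trans (∑-const n 1) (*-identityʳ n) ⟩
    n ∎
    where open ≤-Reasoning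

  -- If all neighbours of ρ were leaves, every walk ending in ρ would stay inside the star of ρ.
  nonLeaf-neighbour : Connected → ∀ {ρ v} → v ≢ ρ → 2 ≤ degree G v → ∃[ x ] (ρ ~ x × 2 ≤ degree G x)
  nonLeaf-neighbour conn {ρ} {v} v≢ρ 2≤v with Fin.any? (λ x → (ρ ~? x) ×-dec (2 ≤? degree G x))
  ... | yes found = found
  ... | no none with inStar (conn v ρ)
    where
    inStar : ∀ {u} → Star _~_ u ρ → u ≡ ρ ⊎ u ~ ρ
    inStar ε = inj₁ refl
    inStar {u} (_◅_ {j = w} u~w w⇝ρ) with inStar w⇝ρ
    ... | inj₁ refl = inj₂ u~w
    ... | inj₂ w~ρ with u Fin.≟ ρ
    ...   | yes u≡ρ = inj₁ u≡ρ
    ...   | no u≢ρ  = contradiction (w , ~-sym w~ρ , degree-2 (~-sym u~w) w~ρ u≢ρ) none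
  ...   | inj₁ v≡ρ = contradiction v≡ρ v≢ρ
  ...   | inj₂ v~ρ = contradiction (v , ~-sym v~ρ , 2≤v) none

  module _ (conn : Connected) (ρ : Fin n) where
    private
      -- Walks are indexed by their length so that their existence is decidable and a shortest one
      -- can be found by search.
      WalkToρ : ℕ → Fin n → Set
      WalkToρ zero    v = v ≡ ρ
      WalkToρ (suc k) v = ∃[ u ] (v ~ u × WalkToρ k u)

      walkToρ? : ∀ v k → Dec (WalkToρ k v)
      walkToρ? v zero    = v Fin.≟ ρ
      walkToρ? v (suc k) = Fin.any? λ u → (v ~? u) ×-dec walkToρ? u k

      walk : ∀ {v} → Star _~_ v ρ → ∃[ k ] WalkToρ k v
      walk ε = 0 , refl
      walk (_◅_ {j = u} v~u u⇝ρ) with k , w ← walk u⇝ρ = suc k , u , v~u , w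

      shortest : ∀ v → ∃[ k ] (WalkToρ k v × ∀ j → WalkToρ j v → k ≤ j)
      shortest v = least (walkToρ? v) (proj₂ (walk (conn v ρ)))

      dist : Fin n → ℕ
      dist v = proj₁ (shortest v)

      -- Dropping the first step of a shortest walk leaves a walk shorter by one, so the next vertex
      -- is strictly closer to `ρ`.
      parent-data : ∀ v → ∃[ u ] ((u ≡ ρ × v ≡ ρ) ⊎ (v ~ u × dist u < dist v))
      parent-data v with shortest v
      ... | zero  , v≡ρ , _           = ρ , inj₁ (refl , v≡ρ)
      ... | suc k , (u , v~u , w) , _ = u , inj₂ (v~u , s≤s (proj₂ (proj₂ (shortest u)) k w))

      parent : Fin n → Fin n
      parent v = proj₁ (parent-data v)

      -- Away from `u = v = ρ` at most one of the two vertices is the parent of the other, and then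
      -- they are adjacent. At `u = v = ρ` each indicator is at most 1, which the last term absorbs.
      parent-pair : ∀ u v → 𝟙 (parent v Fin.≟ u) + 𝟙 (parent u Fin.≟ v) ≤
                            𝟙 (u ~? v) + 2 * (𝟙 (ρ Fin.≟ u) * 𝟙 (ρ Fin.≟ v))
      parent-pair u v = case-root (ρ Fin.≟ u) (ρ Fin.≟ v)
        where
        disjoint : ¬ (u ≡ ρ × v ≡ ρ) →
                   𝟙 (parent v Fin.≟ u) + 𝟙 (parent u Fin.≟ v) ≤ 𝟙 (u ~? v)
        disjoint ¬root = 𝟙-disjoint (parent v Fin.≟ u) (parent u Fin.≟ v) (u ~? v) below above both
          where
          below : parent v ≡ u → u ~ v
          below refl with proj₂ (parent-data v)
          ... | inj₁ root       = contradiction root ¬root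
          ... | inj₂ (v~pv , _) = ~-sym v~pv
          above : parent u ≡ v → u ~ v
          above refl with proj₂ (parent-data u)
          ... | inj₁ (pu≡ρ , u≡ρ) = contradiction (u≡ρ , pu≡ρ) ¬root
          ... | inj₂ (u~pu , _)   = u~pu
          both : ¬ (parent v ≡ u × parent u ≡ v)
          both (pv≡u , pu≡v) with proj₂ (parent-data u) | proj₂ (parent-data v)
          ... | _ | inj₁ (pv≡ρ , v≡ρ) = ¬root (trans (sym pv≡u) pv≡ρ , v≡ρ)
          ... | inj₁ (pu≡ρ , u≡ρ) | _ = ¬root (u≡ρ , trans (sym pu≡v) pu≡ρ)
          ... | inj₂ (_ , pu<u) | inj₂ (_ , pv<v) rewrite pv≡u | pu≡v = <-asym pu<u pv<v

        case-root : (d : Dec (ρ ≡ u)) (e : Dec (ρ ≡ v)) →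
                    𝟙 (parent v Fin.≟ u) + 𝟙 (parent u Fin.≟ v) ≤ 𝟙 (u ~? v) + 2 * (𝟙 d * 𝟙 e)
        case-root (yes _)  (yes _)  = ≤-trans
          (+-mono-≤ (𝟙≤1 (parent v Fin.≟ u)) (𝟙≤1 (parent u Fin.≟ v))) (m≤n+m 2 (𝟙 (u ~? v)))
        case-root (no ρ≢u) _        = ≤-trans (disjoint (ρ≢u ∘ sym ∘ proj₁)) (m≤m+n _ _)
        case-root _        (no ρ≢v) = ≤-trans (disjoint (ρ≢v ∘ sym ∘ proj₂)) (m≤m+n _ _)

    -- The ordered pairs (v, parent v) and (parent v, v) with v ≢ ρ are pairwise distinct, since
    -- parents are strictly closer to ρ; the junk value parent ρ = ρ accounts for the 2.
    connected⇒degreeSum : n + n ≤ degreeSum G + 2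
    connected⇒degreeSum = begin
      n + n
        ≡⟨ cong₂ _+_ (sym parents) (sym (trans (∑-comm {n} {n} (λ u v → 𝟙 (parent u Fin.≟ v))) parents)) ⟩
      ∑∑ (λ u v → 𝟙 (parent v Fin.≟ u)) + ∑∑ (λ u v → 𝟙 (parent u Fin.≟ v))
        ≡⟨ ∑∑-distrib-+ {n} (λ u v → 𝟙 (parent v Fin.≟ u)) (λ u v → 𝟙 (parent u Fin.≟ v)) ⟨
      ∑∑ (λ u v → 𝟙 (parent v Fin.≟ u) + 𝟙 (parent u Fin.≟ v))
        ≤⟨ ∑∑-mono parent-pair ⟩
      ∑∑ (λ u v → 𝟙 (u ~? v) + 2 * δδ u v)
        ≡⟨ ∑∑-distrib-+ {n} (λ u v → 𝟙 (u ~? v)) (λ u v → 2 * δδ u v) ⟩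
      ∑∑ (λ u v → 𝟙 (u ~? v)) + ∑∑ (λ u v → 2 * δδ u v)
        ≡⟨ cong₂ _+_ (sum-cong-≗ {n} (λ u → sym (degree≡∑ G u))) twice ⟩
      degreeSum G + 2 ∎
      where
      open ≤-Reasoning
      δδ : Fin n → Fin n → ℕ
      δδ u v = 𝟙 (ρ Fin.≟ u) * 𝟙 (ρ Fin.≟ v)
      parents : ∑∑ (λ u v → 𝟙 (parent v Fin.≟ u)) ≡ n
      parents = trans (∑-comm {n} {n} (λ u v → 𝟙 (parent v Fin.≟ u)))
        (trans (sum-cong-≗ {n} (λ v → ∑-δ₁ (parent v))) (trans (∑-const n 1) (*-identityʳ n)))
      twice : ∑∑ (λ u v → 2 * δδ u v) ≡ 2
      twice = trans (sum-cong-≗ {n} λ u → sym (*-distribˡ-sum 2 (δδ u)))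
        (trans (sym (*-distribˡ-sum {n} 2 (λ u → ∑ (δδ u)))) (cong (2 *_) (∑∑-δ ρ)))

-- The lower bound

index : (ℕ → ℕ → ℕ) → Graph n → ℕ
index F G = edgeSum (λ u v → F (degree G u) (degree G v)) G

-- The shift by 2c keeps g natural-valued. The constants k and k + e are what is left of F Δ b + 2c after
-- giving away g b, at b = 1 and b = 2, and (α + c) d - β is the secant of d · g d through d = 1 and d = 2.
record EdgeEstimate (F : ℕ → ℕ → ℕ) (g : ℕ → ℕ) (Δ c k e α β : ℕ) : Set where
  field
    F-comm    : ∀ a b → F a b ≡ F b a
    g+g≤F     : ∀ s t → g (1 + s) + g (1 + t) ≤ F (1 + s) (1 + t) + (c + c)
    k+g≤F     : ∀ t → k + g (1 + t) ≤ F Δ (1 + t) + (c + c)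
    k+e+g≤F   : ∀ t → k + e + g (2 + t) ≤ F Δ (2 + t) + (c + c)
    secant    : ∀ d → (α + c) * d ≤ d * g d + β
    secant-<  : ∀ {d} → 3 ≤ d → (α + c) * d < d * g d + β

module _ {F : ℕ → ℕ → ℕ} {g : ℕ → ℕ} {Δ c k e α β : ℕ} (E : EdgeEstimate F g Δ c k e α β)
         {n : ℕ} (G : Graph n) (conn : Graph.Connected G) {ρ v : Fin n} (ρ-hub : degree G ρ ≡ Δ)
         (v≢ρ : v ≢ ρ) (3≤v : 3 ≤ degree G v) where

  open Graph G using (_~_; _~?_; ~-sym; ~-irrefl)
  open EdgeEstimate E

  private
    deg : Fin n → ℕ
    deg = degree G

    -- The edge from `ρ` to a non-leaf leaves the extra amount `e` for `ρ`; the vertex `v`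
    -- guarantees that such an edge exists.
    xs : ∃[ x ] (ρ ~ x × 2 ≤ degree G x)
    xs = nonLeaf-neighbour G conn v≢ρ (≤-trans (s≤s (s≤s z≤n)) 3≤v)

    x₀ : Fin n
    x₀ = proj₁ xs

    -- What `u` receives from the edge to `w`. The decision is an argument so that the rows of `ρ`
    -- and of the other vertices can be treated by matching on it.
    share′ : ∀ {u} → Dec (ρ ≡ u) → Fin n → ℕ
    share′ (yes _)    w = k + 𝟙 (x₀ Fin.≟ w) * e
    share′ {u} (no _) w = g (deg u)

    share : Fin n → Fin n → ℕ
    share u w = share′ (ρ Fin.≟ u) w

    pair-≤ : ∀ {a b} → 1 ≤ a → 1 ≤ b → g a + g b ≤ F a b + (c + c)
    pair-≤ (s≤s {n = s} _) (s≤s {n = t} _) = g+g≤F s t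

    hub-≤₁ : ∀ {b} → 1 ≤ b → k + g b ≤ F Δ b + (c + c)
    hub-≤₁ (s≤s {n = t} _) = k+g≤F t

    hub-≤₂ : ∀ {b} → 2 ≤ b → k + e + g b ≤ F Δ b + (c + c)
    hub-≤₂ (s≤s (s≤s {n = t} _)) = k+e+g≤F t

    hub-share : ∀ {w} → ρ ~ w → k + 𝟙 (x₀ Fin.≟ w) * e + g (deg w) ≤ F Δ (deg w) + (c + c)
    hub-share {w} ρ~w with x₀ Fin.≟ w
    ... | yes refl rewrite +-identityʳ e = hub-≤₂ (proj₂ (proj₂ xs))
    ... | no _     rewrite +-identityʳ k = hub-≤₁ (degree-1 G (~-sym ρ~w))

    share-≤ : ∀ {u w} → u ~ w → share u w + share w u ≤ F (deg u) (deg w) + (c + c)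
    share-≤ {u} {w} u~w with ρ Fin.≟ u | ρ Fin.≟ w
    ... | yes refl | yes refl = contradiction u~w (~-irrefl refl)
    ... | yes refl | no _     rewrite ρ-hub = hub-share u~w
    ... | no _     | yes refl rewrite ρ-hub | F-comm (deg u) Δ | +-comm (g (deg u)) (k + 𝟙 (x₀ Fin.≟ u) * e) =
      hub-share (~-sym u~w)
    ... | no _     | no _     = pair-≤ (degree-1 G u~w) (degree-1 G (~-sym u~w))

    row : Fin n → ℕ
    row u = ∑[ w < n ] (𝟙 (u ~? w) * share u w)

    row-const : ∀ u z → ∑[ w < n ] (𝟙 (u ~? w) * z) ≡ deg u * z
    row-const u z = trans (sym (*-distribʳ-sum z (λ w → 𝟙 (u ~? w)))) (cong (_* z) (sym (degree≡∑ G u)))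

    -- No edge pays out more than its weight plus the shift `c + c`, and by the handshake lemma the
    -- shifts add up to `degreeSum G * c`.
    ∑-row : ∑[ u < n ] row u ≤ index F G + degreeSum G * c
    ∑-row = begin
      ∑∑ (λ u w → 𝟙 (u ~? w) * share u w)
        ≡⟨ edgeSum-symmetrise G share ⟨
      edgeSum (λ u w → share u w + share w u) G
        ≤⟨ edgeSum-mono G (λ u w → share-≤) ⟩
      edgeSum (λ u w → F (deg u) (deg w) + (c + c)) G
        ≡⟨ edgeSum-+ (λ u w → F (deg u) (deg w)) (λ _ _ → c + c) G ⟩
      index F G + edgeSum (λ _ _ → c + c) G
        ≡⟨ cong (index F G +_) (edgeSum-symmetrise G (λ _ _ → c)) ⟩
      index F G + ∑∑ (λ u w → 𝟙 (u ~? w) * c)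
        ≡⟨ cong (index F G +_) (trans (sum-cong-≗ {n} (λ u → row-const u c)) (sym (*-distribʳ-sum c deg))) ⟩
      index F G + degreeSum G * c ∎
      where open ≤-Reasoning

    hub-row : Δ * k + e ≤ ∑[ w < n ] (𝟙 (ρ ~? w) * (k + 𝟙 (x₀ Fin.≟ w) * e))
    hub-row = begin
      Δ * k + e
        ≡⟨ cong₂ _+_ (trans (cong (_* k) (sym ρ-hub)) (sym (row-const ρ k))) (sym (∑-δ x₀ (λ _ → e))) ⟩
      (∑[ w < n ] (𝟙 (ρ ~? w) * k)) + (∑[ w < n ] (𝟙 (x₀ Fin.≟ w) * e))
        ≡⟨ ∑-distrib-+ {n} (λ w → 𝟙 (ρ ~? w) * k) (λ w → 𝟙 (x₀ Fin.≟ w) * e) ⟨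
      ∑[ w < n ] (𝟙 (ρ ~? w) * k + 𝟙 (x₀ Fin.≟ w) * e)
        ≤⟨ ∑-mono {n} pointwise ⟩
      ∑[ w < n ] (𝟙 (ρ ~? w) * (k + 𝟙 (x₀ Fin.≟ w) * e)) ∎
      where
      open ≤-Reasoning
      pointwise : ∀ w → 𝟙 (ρ ~? w) * k + 𝟙 (x₀ Fin.≟ w) * e ≤ 𝟙 (ρ ~? w) * (k + 𝟙 (x₀ Fin.≟ w) * e)
      pointwise w with ρ ~? w | x₀ Fin.≟ w
      ... | yes _   | d        = ≤-reflexive (ones k (𝟙 d * e))
        where
        ones : ∀ a b → 1 * a + b ≡ 1 * (a + b)
        ones = solve-∀
      ... | no ¬ρ~w | yes refl = contradiction (proj₁ (proj₂ xs)) ¬ρ~w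
      ... | no _    | no _     = z≤n

    H : ℕ
    H = Δ * k + e + β

    -- For `u ≢ ρ` this is the secant bound, and the extra 1 at `u = v` is its strictness at degrees
    -- from 3 on. At `ρ` the terms `(α + c) * Δ` and `β` occur on both sides, and `hub-row` remains.
    row-≥ : ∀ u (d : Dec (ρ ≡ u)) →
      (α + c) * deg u + (𝟙 (v Fin.≟ u) + 𝟙 d * H) ≤
      (∑[ w < n ] (𝟙 (u ~? w) * share′ d w)) + (β + 𝟙 d * ((α + c) * Δ))
    row-≥ u (yes refl) rewrite 𝟙-no (v Fin.≟ ρ) v≢ρ | ρ-hub = begin
      A + (0 + 1 * (B + β)) ≡⟨ move A B β ⟩
      B + (β + 1 * A)       ≤⟨ +-monoˡ-≤ (β + 1 * A) hub-row ⟩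
      (∑[ w < n ] (𝟙 (ρ ~? w) * (k + 𝟙 (x₀ Fin.≟ w) * e))) + (β + 1 * A) ∎
      where
      open ≤-Reasoning
      A B : ℕ
      A = (α + c) * Δ
      B = Δ * k + e
      move : ∀ x y z → x + (0 + 1 * (y + z)) ≡ y + (z + 1 * x)
      move = solve-∀
    row-≥ u (no _) rewrite row-const u (g (deg u)) | +-identityʳ (𝟙 (v Fin.≟ u)) | +-identityʳ β
      with v Fin.≟ u
    ... | yes refl rewrite +-comm ((α + c) * deg v) 1 = secant-< 3≤v
    ... | no _     rewrite +-identityʳ ((α + c) * deg u) = secant (deg u)

    ∑-row-≥ : (α + c) * degreeSum G + (1 + H) ≤ (∑[ u < n ] row u) + (n * β + (α + c) * Δ)
    ∑-row-≥ = begin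
      (α + c) * degreeSum G + (1 + H)
        ≡⟨ cong₂ _+_ (*-distribˡ-sum (α + c) deg) (cong₂ _+_ (sym (∑-δ₁ v)) (sym (∑-δ ρ (λ _ → H)))) ⟩
      (∑[ u < n ] ((α + c) * deg u)) + ((∑[ u < n ] 𝟙 (v Fin.≟ u)) + (∑[ u < n ] (𝟙 (ρ Fin.≟ u) * H)))
        ≡⟨ cong ((∑[ u < n ] ((α + c) * deg u)) +_)
             (∑-distrib-+ {n} (λ u → 𝟙 (v Fin.≟ u)) (λ u → 𝟙 (ρ Fin.≟ u) * H)) ⟨
      (∑[ u < n ] ((α + c) * deg u)) + (∑[ u < n ] (𝟙 (v Fin.≟ u) + 𝟙 (ρ Fin.≟ u) * H))
        ≡⟨ ∑-distrib-+ {n} (λ u → (α + c) * deg u) (λ u → 𝟙 (v Fin.≟ u) + 𝟙 (ρ Fin.≟ u) * H) ⟨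
      ∑[ u < n ] ((α + c) * deg u + (𝟙 (v Fin.≟ u) + 𝟙 (ρ Fin.≟ u) * H))
        ≤⟨ ∑-mono {n} (λ u → row-≥ u (ρ Fin.≟ u)) ⟩
      ∑[ u < n ] (row u + (β + 𝟙 (ρ Fin.≟ u) * A))
        ≡⟨ ∑-distrib-+ {n} row (λ u → β + 𝟙 (ρ Fin.≟ u) * A) ⟩
      (∑[ u < n ] row u) + (∑[ u < n ] (β + 𝟙 (ρ Fin.≟ u) * A))
        ≡⟨ cong ((∑[ u < n ] row u) +_) (trans (∑-distrib-+ {n} (λ _ → β) (λ u → 𝟙 (ρ Fin.≟ u) * A))
             (cong₂ _+_ (∑-const n β) (∑-δ ρ (λ _ → A)))) ⟩
      (∑[ u < n ] row u) + (n * β + A) ∎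
      where
      open ≤-Reasoning
      A : ℕ
      A = (α + c) * Δ

  -- The lower and upper estimates of the total of all shares are compared. The multiples of
  -- `c * degreeSum G` cancel, and `α * degreeSum G` is at least `2 * α * N` by connectedness.
  -- Strictness is the 1 contributed by `v`.
  index-lowerBound : ∀ {N} → n ≡ suc N →
    2 * α * N + Δ * k + e < index F G + (β * N + (α + c) * Δ)
  -- The cancelled `β` is the one inside `H`; it reduces the `suc N` copies on the right to `N`.
  index-lowerBound {N} refl = +-cancelˡ-≤ (degreeSum G * c + β) _ _ (begin
    D * c + β + suc (2 * α * N + Δ * k + e)
      ≡⟨ regroupˡ D c β α N Δ k e ⟩
    α * (N + N) + (c * D + (1 + H))
      ≤⟨ +-monoˡ-≤ (c * D + (1 + H)) (*-monoʳ-≤ α N+N≤D) ⟩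
    α * D + (c * D + (1 + H))
      ≡⟨ regroupᵐ α D c H ⟩
    (α + c) * D + (1 + H)
      ≤⟨ ∑-row-≥ ⟩
    (∑[ u < n ] row u) + (n * β + (α + c) * Δ)
      ≤⟨ +-monoˡ-≤ (n * β + (α + c) * Δ) ∑-row ⟩
    index F G + D * c + (n * β + (α + c) * Δ)
      ≡⟨ regroupʳ (index F G) D c N β ((α + c) * Δ) ⟩
    D * c + β + (index F G + (β * N + (α + c) * Δ)) ∎)
    where
    open ≤-Reasoning
    D : ℕ
    D = degreeSum G
    N+N≤D : N + N ≤ D
    N+N≤D = +-cancelʳ-≤ 2 (N + N) D (≤-trans (≤-reflexive (shift N)) (connected⇒degreeSum G conn ρ))
      where
      shift : ∀ N → N + N + 2 ≡ suc N + suc N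
      shift = solve-∀
    regroupˡ : ∀ D c β α N Δ k e → D * c + β + suc (2 * α * N + Δ * k + e) ≡
                                   α * (N + N) + (c * D + (1 + (Δ * k + e + β)))
    regroupˡ = solve-∀
    regroupᵐ : ∀ α D c H → α * D + (c * D + (1 + H)) ≡ (α + c) * D + (1 + H)
    regroupᵐ = solve-∀
    regroupʳ : ∀ I D c N β A → I + D * c + (suc N * β + A) ≡ D * c + β + (I + (β * N + A))
    regroupʳ = solve-∀

-- Brooms

-- A rooted tree given by parent pointers: `parent i` belongs to the vertex `suc i`, so the weak
-- inequality makes every parent strictly smaller than its child.
module ParentTree {N : ℕ} (parent : Fin N → Fin (suc N))
                  (parent≤ : ∀ i → toℕ (parent i) ≤ toℕ i) where

  infix 4 _◁_ _◁?_ _~_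

  _◁_ : Fin (suc N) → Fin (suc N) → Set
  u ◁ zero  = ⊥
  u ◁ suc i = parent i ≡ u

  _◁?_ : ∀ u v → Dec (u ◁ v)
  u ◁? zero  = no λ ()
  u ◁? suc i = parent i Fin.≟ u

  ◁⇒< : ∀ {u v} → u ◁ v → u Fin.< v
  ◁⇒< {v = suc i} refl = s≤s (parent≤ i)

  ◁-unique : ∀ {u u′ v} → u ◁ v → u′ ◁ v → u ≡ u′
  ◁-unique {v = suc i} refl refl = refl

  ◁-asym : ∀ {u v} → ¬ (u ◁ v × v ◁ u)
  ◁-asym {u} {v} (u◁v , v◁u) = <-asym (◁⇒< {u} {v} u◁v) (◁⇒< {v} {u} v◁u)

  _~_ : Fin (suc N) → Fin (suc N) → Set
  u ~ v = u ◁ v ⊎ v ◁ u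

  tree : Graph (suc N)
  tree = record
    { _~_      = _~_
    ; _~?_     = λ u v → (u ◁? v) ⊎-dec (v ◁? u)
    ; ~-sym    = swap
    ; ~-irrefl = λ { {u} refl → [ irrefl u , irrefl u ]′ }
    }
    where
    irrefl : ∀ u → ¬ (u ◁ u)
    irrefl u u◁u = ◁-asym {u} {u} (u◁u , u◁u)

  connected : Graph.Connected tree
  connected u v = toRoot (toℕ u) u ≤-refl Star.◅◅ Star.reverse swap (toRoot (toℕ v) v ≤-refl)
    where
    -- The bound `k` on the vertex number carries the recursion, since `parent i` is not
    -- structurally smaller than `suc i`.
    toRoot : ∀ k u → toℕ u ≤ k → Star _~_ u zero
    toRoot _       zero    _         = ε
    toRoot (suc k) (suc i) (s≤s i≤k) = inj₂ refl ◅ toRoot k (parent i) (≤-trans (parent≤ i) i≤k)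

  private
    V : Set
    V = Fin (suc N)

    lastOf : V → List V → V
    lastOf b []       = b
    lastOf b (c ∷ ys) = lastOf c ys

    All-lastOf : ∀ {P : V → Set} {b} ys → All P (b ∷ ys) → P (lastOf b ys)
    All-lastOf []       (pb ∷ _) = pb
    All-lastOf (c ∷ ys) (_ ∷ ps) = All-lastOf ys ps

  -- A walk that never backtracks cannot descend after an ascending step.
  ascending : ∀ {a b v} ys → a ◁ b → Linked _~_ (b ∷ ys ++ [ v ]) → Unique (a ∷ b ∷ ys) →
              All (v ≢_) (a ∷ b ∷ ys) → b Fin.< v × lastOf b ys ◁ v
  ascending {a} {b} {v} [] a◁b (inj₁ b◁v ∷ _) _ _ = ◁⇒< {b} {v} b◁v , b◁v
  ascending {a} {b} {v} [] a◁b (inj₂ v◁b ∷ _) _ (v≢a ∷ _) = contradiction (◁-unique {v} {a} {b} v◁b a◁b) v≢a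
  ascending {a} {b} {v} (c ∷ ys) a◁b (inj₁ b◁c ∷ l) (_ ∷ uniq) (_ ∷ v∉)
    with c<v , last◁v ← ascending {b} {c} {v} ys b◁c l uniq v∉ =
    <-trans (◁⇒< {b} {c} b◁c) c<v , last◁v
  ascending {a} {b} {v} (c ∷ ys) a◁b (inj₂ c◁b ∷ l) ((_ ∷ a≢c ∷ _) ∷ _) _ =
    contradiction (◁-unique {a} {c} {b} a◁b c◁b) a≢c

  -- A walk that never backtracks first descends towards the root and then ascends. If it only
  -- descends, it starts above `v`; after its first ascending step it keeps ascending and enters `v`
  -- from the parent of `v`.
  below-or-last : ∀ {b v} ys → Linked _~_ (b ∷ ys ++ [ v ]) → Unique (b ∷ ys) →
                  All (v ≢_) (b ∷ ys) → v Fin.< b ⊎ lastOf b ys ◁ v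
  below-or-last {b} {v} [] (inj₁ b◁v ∷ _) _ _ = inj₂ b◁v
  below-or-last {b} {v} [] (inj₂ v◁b ∷ _) _ _ = inj₁ (◁⇒< {v} {b} v◁b)
  below-or-last {b} {v} (c ∷ ys) (inj₁ b◁c ∷ l) uniq v∉ = inj₂ (proj₂ (ascending {b} {c} {v} ys b◁c l uniq v∉))
  below-or-last {b} {v} (c ∷ ys) (inj₂ c◁b ∷ l) (_ ∷ uniq) (_ ∷ v∉) with below-or-last {c} {v} ys l uniq v∉
  ... | inj₁ v<c    = inj₁ (<-trans v<c (◁⇒< {c} {b} c◁b))
  ... | inj₂ last◁v = inj₂ last◁v

  -- A cycle that leaves `v` upwards either turns back at once to `v` or keeps ascending and cannot
  -- return. One that leaves `v` towards its parent `x` must come back through that same parent, so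
  -- `x` would be repeated.
  acyclic : Graph.Acyclic tree
  acyclic v (x ∷ []) (s≤s () , _)
  acyclic v (x ∷ y ∷ ys) (_ , (_ ∷ v≢y ∷ _) ∷ _ , inj₁ v◁x ∷ inj₂ y◁x ∷ _) =
    v≢y (◁-unique {v} {y} {x} v◁x y◁x)
  acyclic v (x ∷ y ∷ ys) (_ , v∉ ∷ uniq , inj₁ v◁x ∷ inj₁ x◁y ∷ l) =
    <-asym (<-trans (◁⇒< {v} {x} v◁x) (◁⇒< {x} {y} x◁y))
           (proj₁ (ascending {x} {y} {v} ys x◁y l uniq v∉))
  acyclic v (x ∷ y ∷ ys) (_ , v∉ ∷ uniq@(x∉ ∷ _) , inj₂ x◁v ∷ l) with below-or-last {x} {v} (y ∷ ys) l uniq v∉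
  ... | inj₁ v<x    = <-asym v<x (◁⇒< {x} {v} x◁v)
  ... | inj₂ last◁v = All-lastOf ys x∉ (◁-unique {x} {lastOf y ys} {v} x◁v last◁v)

  isTree : IsTree tree
  isTree = record { nonEmpty = zero ; connected = connected ; acyclic = acyclic }

  children : Fin (suc N) → ℕ
  children u = ∑[ i < N ] 𝟙 (parent i Fin.≟ u)

  private
    degree≡up+down : ∀ u → degree tree u ≡ children u + ∑[ v < suc N ] 𝟙 (v ◁? u)
    degree≡up+down u = begin
      degree tree u
        ≡⟨ degree≡∑ tree u ⟩
      ∑[ v < suc N ] 𝟙 ((u ◁? v) ⊎-dec (v ◁? u))
        ≡⟨ sum-cong-≗ {suc N} (λ v → 𝟙-⊎ (u ◁? v) (v ◁? u) (◁-asym {u} {v})) ⟩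
      ∑[ v < suc N ] (𝟙 (u ◁? v) + 𝟙 (v ◁? u))
        -- The root has no parent, so the term `v = zero` of the first sum vanishes and the sum is
        -- `children u` by computation.
        ≡⟨ ∑-distrib-+ {suc N} (λ v → 𝟙 (u ◁? v)) (λ v → 𝟙 (v ◁? u)) ⟩
      children u + ∑[ v < suc N ] 𝟙 (v ◁? u) ∎
      where open ≡-Reasoning

  degree-root : degree tree zero ≡ children zero
  degree-root = trans (degree≡up+down zero)
    (trans (cong (children zero +_) (∑-zero {suc N} λ _ → refl)) (+-identityʳ _))

  degree-child : ∀ i → degree tree (suc i) ≡ suc (children (suc i))
  degree-child i = trans (degree≡up+down (suc i))
    (trans (cong (children (suc i) +_) (∑-δ₁ (parent i))) (+-comm (children (suc i)) 1))

  -- The edges correspond to the non-root vertices, each joined to its parent, which has the smaller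
  -- number and is therefore listed first.
  edgeSum-tree : (L : Fin (suc N) → Fin (suc N) → ℕ) → edgeSum L tree ≡ ∑[ i < N ] L (parent i) (suc i)
  edgeSum-tree L = begin
    edgeSum L tree
      ≡⟨ edgeSum≡∑∑ tree L ⟩
    ∑∑ (λ u v → 𝟙 ((u Fin.<? v) ×-dec ((u ◁? v) ⊎-dec (v ◁? u))) * L u v)
      ≡⟨ ∑∑-cong (λ u v → cong (_* L u v) (𝟙-cong ((u Fin.<? v) ×-dec ((u ◁? v) ⊎-dec (v ◁? u))) (u ◁? v)
           (oriented {u} {v}) (λ u◁v → ◁⇒< {u} {v} u◁v , inj₁ u◁v))) ⟩
    ∑∑ (λ u v → 𝟙 (u ◁? v) * L u v)
      ≡⟨ ∑-comm {suc N} {suc N} (λ u v → 𝟙 (u ◁? v) * L u v) ⟩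
    (∑[ u < suc N ] 0) + (∑[ i < N ] ∑[ u < suc N ] (𝟙 (parent i Fin.≟ u) * L u (suc i)))
      ≡⟨ cong₂ _+_ (∑-zero {suc N} λ _ → refl) (sum-cong-≗ {N} λ i → ∑-δ (parent i) (λ u → L u (suc i))) ⟩
    ∑[ i < N ] L (parent i) (suc i) ∎
    where
    open ≡-Reasoning
    oriented : ∀ {u v} → u Fin.< v × (u ◁ v ⊎ v ◁ u) → u ◁ v
    oriented (_ , inj₁ u◁v) = u◁v
    oriented {u} {v} (u<v , inj₂ v◁u) = contradiction (◁⇒< {v} {u} v◁u) (<-asym u<v)

-- The centre 0 has the m + 1 neighbours 1, …, m + 1, and a path of k further vertices hangs off vertex m + 1.
module Broom (m k : ℕ) where

  -- The index `i` stands for the vertex `suc i`. On the tail the parent of `suc i` is the vertex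
  -- with the preceding number.
  broomParent : Fin (suc m + k) → Fin (suc (suc m + k))
  broomParent i = [ const zero , (λ j → inject₁ (suc m ↑ʳ j)) ]′ (splitAt (suc m) i)

  broomParent≤ : ∀ i → toℕ (broomParent i) ≤ toℕ i
  broomParent≤ i with splitAt (suc m) i in eq
  ... | inj₁ _ = z≤n
  ... | inj₂ j = ≤-reflexive (trans (Fin.toℕ-inject₁ (suc m ↑ʳ j)) (cong toℕ (Fin.splitAt⁻¹-↑ʳ eq)))

  broomParent-leg : ∀ i → broomParent (i ↑ˡ k) ≡ zero
  broomParent-leg i rewrite Fin.splitAt-↑ˡ (suc m) i k = refl

  broomParent-tail : ∀ j → broomParent (suc m ↑ʳ j) ≡ inject₁ (suc m ↑ʳ j)
  broomParent-tail j rewrite Fin.splitAt-↑ʳ (suc m) k j = refl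

  open ParentTree broomParent broomParent≤ public

  tailChildren : Fin (suc (suc m + k)) → ℕ
  tailChildren u = ∑[ j < k ] 𝟙 (inject₁ (suc m ↑ʳ j) Fin.≟ u)

  children≡ : ∀ u → children u ≡ suc m * 𝟙 (zero Fin.≟ u) + tailChildren u
  children≡ u = begin
    children u
      ≡⟨ ∑-split (suc m) k (λ i → 𝟙 (broomParent i Fin.≟ u)) ⟩
    (∑[ i < suc m ] 𝟙 (broomParent (i ↑ˡ k) Fin.≟ u)) + (∑[ j < k ] 𝟙 (broomParent (suc m ↑ʳ j) Fin.≟ u))
      ≡⟨ cong₂ _+_ (trans (sum-cong-≗ {suc m} λ i → cong (λ p → 𝟙 (p Fin.≟ u)) (broomParent-leg i))
                          (∑-const (suc m) (𝟙 (zero Fin.≟ u))))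
                   (sum-cong-≗ {k} λ j → cong (λ p → 𝟙 (p Fin.≟ u)) (broomParent-tail j)) ⟩
    suc m * 𝟙 (zero Fin.≟ u) + tailChildren u ∎
    where open ≡-Reasoning

  degree-centre : degree tree zero ≡ suc m
  degree-centre = trans degree-root (trans (children≡ zero)
    (trans (cong₂ _+_ (*-identityʳ (suc m)) (∑-zero {k} λ _ → refl)) (+-identityʳ (suc m))))

  degree-suc : ∀ i → degree tree (suc i) ≡ suc (tailChildren (suc i))
  degree-suc i = trans (degree-child i) (cong suc
    (trans (children≡ (suc i)) (cong (_+ tailChildren (suc i)) (*-zeroʳ (suc m)))))

  -- The parents of the tail vertices are pairwise distinct, so a vertex other than the centre has
  -- at most one child.
  degree-suc-≤2 : ∀ i → degree tree (suc i) ≤ 2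
  degree-suc-≤2 i = ≤-trans (≤-reflexive (degree-suc i))
    (s≤s (∑-𝟙≤1 {k} (λ j → inject₁ (suc m ↑ʳ j) Fin.≟ suc i)
      λ p q → Fin.↑ʳ-injective (suc m) _ _ (Fin.inject₁-injective (trans p (sym q)))))

  degree-leaf : ∀ i → (∀ (j : Fin k) → suc m + toℕ j ≢ suc (toℕ i)) → degree tree (suc i) ≡ 1
  degree-leaf i ¬child = trans (degree-suc i) (cong suc (∑-zero {k} λ j →
    𝟙-no (inject₁ (suc m ↑ʳ j) Fin.≟ suc i) λ eq → ¬child j
      (trans (sym (trans (Fin.toℕ-inject₁ (suc m ↑ʳ j)) (Fin.toℕ-↑ʳ (suc m) j))) (cong toℕ eq))))

  maxDegree : 1 ≤ m → MaxDegree tree (suc m)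
  maxDegree 1≤m = record { bounded = bounded ; attained = zero , degree-centre }
    where
    bounded : ∀ v → degree tree v ≤ suc m
    bounded zero    = ≤-reflexive degree-centre
    bounded (suc i) = ≤-trans (degree-suc-≤2 i) (s≤s 1≤m)

  -- `inject₁` leaves out the last leg, the one to which the tail, if any, is attached.
  degree-leg : ∀ i → degree tree (suc (inject₁ i ↑ˡ k)) ≡ 1
  degree-leg i = degree-leaf (inject₁ i ↑ˡ k) λ j eq →
    <⇒≢ (≤-trans (s≤s (Fin.toℕ<n i)) (m≤m+n (suc m) (toℕ j)))
      (sym (trans eq (cong suc (trans (Fin.toℕ-↑ˡ (inject₁ i) k) (Fin.toℕ-inject₁ i)))))

  index-tree : (F : ℕ → ℕ → ℕ) → index F tree ≡
    ((∑[ i < m ] F (suc m) (degree tree (suc (inject₁ i ↑ˡ k)))) + F (suc m) (degree tree (suc (fromℕ m ↑ˡ k)))) +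
    (∑[ j < k ] F (degree tree (inject₁ (suc m ↑ʳ j))) (degree tree (suc (suc m ↑ʳ j))))
  index-tree F = begin
    index F tree
      ≡⟨ edgeSum-tree (λ u v → F (deg u) (deg v)) ⟩
    ∑[ i < suc m + k ] F (deg (broomParent i)) (deg (suc i))
      ≡⟨ ∑-split (suc m) k (λ i → F (deg (broomParent i)) (deg (suc i))) ⟩
    (∑[ i < suc m ] F (deg (broomParent (i ↑ˡ k))) (deg (suc (i ↑ˡ k)))) +
    (∑[ j < k ] F (deg (broomParent (suc m ↑ʳ j))) (deg (suc (suc m ↑ʳ j))))
      ≡⟨ cong₂ _+_ (sum-cong-≗ {suc m} λ i → cong (λ d → F d (deg (suc (i ↑ˡ k))))
                       (trans (cong deg (broomParent-leg i)) degree-centre))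
                   (sum-cong-≗ {k} λ j → cong (λ p → F (deg p) (deg (suc (suc m ↑ʳ j)))) (broomParent-tail j)) ⟩
    (∑[ i < suc m ] F (suc m) (deg (suc (i ↑ˡ k)))) +
    (∑[ j < k ] F (deg (inject₁ (suc m ↑ʳ j))) (deg (suc (suc m ↑ʳ j))))
      ≡⟨ cong (_+ (∑[ j < k ] F (deg (inject₁ (suc m ↑ʳ j))) (deg (suc (suc m ↑ʳ j)))))
              (sum-init-last (λ i → F (suc m) (deg (suc (i ↑ˡ k))))) ⟩
    ((∑[ i < m ] F (suc m) (deg (suc (inject₁ i ↑ˡ k)))) + F (suc m) (deg (suc (fromℕ m ↑ˡ k)))) +
    (∑[ j < k ] F (deg (inject₁ (suc m ↑ʳ j))) (deg (suc (suc m ↑ʳ j)))) ∎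
    where
    open ≡-Reasoning
    deg : Fin (suc (suc m + k)) → ℕ
    deg = degree tree

  ∑-legs : (F : ℕ → ℕ → ℕ) → ∑[ i < m ] F (suc m) (degree tree (suc (inject₁ i ↑ˡ k))) ≡ m * F (suc m) 1
  ∑-legs F = trans (sum-cong-≗ {m} λ i → cong (F (suc m)) (degree-leg i)) (∑-const m (F (suc m) 1))

open Broom using (tree)

module _ (F : ℕ → ℕ → ℕ) (F-mono : ∀ {a b c d} → a ≤ b → c ≤ d → F a c ≤ F b d) (m : ℕ) where
  index-star : index F (tree m 0) ≤ m * F (suc m) 1 + F (suc m) 1
  index-star = begin
    index F (tree m 0)
      ≡⟨ index-tree F ⟩
    _ + F (suc m) (degree (tree m 0) (suc (fromℕ m ↑ˡ 0))) + 0
      ≡⟨ +-identityʳ _ ⟩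
    _ + F (suc m) (degree (tree m 0) (suc (fromℕ m ↑ˡ 0)))
      ≡⟨ cong₂ _+_ (∑-legs F) (cong (F (suc m)) (degree-leaf (fromℕ m ↑ˡ 0) λ ())) ⟩
    m * F (suc m) 1 + F (suc m) 1 ∎
    where
    open ≤-Reasoning
    open Broom m 0 hiding (tree)

  -- As an upper bound suffices, monotonicity of `F` and the bound 2 on the degrees outside the
  -- centre replace exact degrees on the last leg and inside the tail.
  index-broom : ∀ k → index F (tree m (suc k)) ≤ m * F (suc m) 1 + F (suc m) 2 + (k * F 2 2 + F 2 1)
  index-broom k = begin
    index F (tree m (suc k))
      ≡⟨ trans (index-tree F) (cong (legs +_) (sum-init-last {k} tail)) ⟩
    legs + ((∑[ j < k ] tail (inject₁ j)) + tail (fromℕ k))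
      ≤⟨ +-mono-≤ (+-mono-≤ (≤-reflexive (∑-legs F)) (F-mono (≤-refl {suc m}) (degree-suc-≤2 (fromℕ m ↑ˡ suc k))))
           -- `inject₁ (suc m ↑ʳ j)` reduces to `suc (inject₁ (m ↑ʳ j))`, which shows that parents
           -- of tail vertices differ from the centre.
           (+-mono-≤ (≤-trans (∑-mono {k} λ j → F-mono (degree-suc-≤2 (inject₁ (m ↑ʳ inject₁ j)))
                                                     (degree-suc-≤2 (suc m ↑ʳ inject₁ j)))
                              (≤-reflexive (∑-const k (F 2 2))))
                     (F-mono (degree-suc-≤2 (inject₁ (m ↑ʳ fromℕ k)))
                             (≤-reflexive (degree-leaf (suc m ↑ʳ fromℕ k) last-childless)))) ⟩
    m * F (suc m) 1 + F (suc m) 2 + (k * F 2 2 + F 2 1) ∎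
    where
    open ≤-Reasoning
    open Broom m (suc k) hiding (tree)
    deg : Fin (suc (suc m + suc k)) → ℕ
    deg = degree (tree m (suc k))
    legs : ℕ
    legs = (∑[ i < m ] F (suc m) (deg (suc (inject₁ i ↑ˡ suc k)))) + F (suc m) (deg (suc (fromℕ m ↑ˡ suc k)))
    tail : Fin (suc k) → ℕ
    tail j = F (deg (inject₁ (suc m ↑ʳ j))) (deg (suc (suc m ↑ʳ j)))
    last-childless : ∀ j → suc m + toℕ j ≢ suc (toℕ (suc m ↑ʳ fromℕ k))
    last-childless j = <⇒≢ (s≤s (≤-trans (+-monoʳ-≤ (suc m) (s≤s⁻¹ (Fin.toℕ<n j)))
      (≤-reflexive (sym (trans (Fin.toℕ-↑ʳ (suc m) (fromℕ k)) (cong (suc m +_) (Fin.toℕ-fromℕ k)))))))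

-- Exponential

module _ {p q : ℚ} (0≤p : 0ℚ ℚ.≤ p) (p<q : p ℚ.< q) where
  private
    p≤q : p ℚ.≤ q
    p≤q = ℚ.<⇒≤ p<q

    1/suc-nonNeg : ∀ i → ℚ.NonNegative (ℤ.+ 1 / suc i)
    1/suc-nonNeg i = ℚ.normalize-nonNeg 1 (suc i)

    *-nonNeg : ∀ {x y} → 0ℚ ℚ.≤ x → 0ℚ ℚ.≤ y → 0ℚ ℚ.≤ x ℚ.* y
    *-nonNeg {x} {y} 0≤x 0≤y = ℚ.nonNegative⁻¹ _
      {{ℚ.nonNeg*nonNeg⇒nonNeg x {{ℚ.nonNegative 0≤x}} y {{ℚ.nonNegative 0≤y}}}}

    factor-nonNeg : ∀ {x} → 0ℚ ℚ.≤ x → ∀ i → 0ℚ ℚ.≤ x ℚ.* (ℤ.+ 1 / suc i)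
    factor-nonNeg 0≤x i = *-nonNeg 0≤x (ℚ.nonNegative⁻¹ _ {{1/suc-nonNeg i}})

  expTerm-nonNeg : ∀ i → 0ℚ ℚ.≤ expTerm p i
  expTerm-nonNeg zero    = ℚ.nonNegative⁻¹ 1ℚ
  expTerm-nonNeg (suc i) = *-nonNeg (expTerm-nonNeg i) (factor-nonNeg 0≤p i)

  expTerm-mono : ∀ i → expTerm p i ℚ.≤ expTerm q i
  expTerm-mono zero    = ℚ.≤-refl
  expTerm-mono (suc i) = ℚ.≤-trans
    (ℚ.*-monoˡ-≤-nonNeg (expTerm p i) {{ℚ.nonNegative (expTerm-nonNeg i)}}
      (ℚ.*-monoʳ-≤-nonNeg (ℤ.+ 1 / suc i) {{1/suc-nonNeg i}} p≤q))
    (ℚ.*-monoʳ-≤-nonNeg (q ℚ.* (ℤ.+ 1 / suc i))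
      {{ℚ.nonNegative (factor-nonNeg (ℚ.≤-trans 0≤p p≤q) i)}} (expTerm-mono i))

  -- The partial sums with two terms are `1 + p` and `1 + q`. Every later term for `q` is at least
  -- the one for `p`, so the gap never shrinks.
  exp-mono-< : exp p <ℝ exp q
  -- A rational `r` strictly between `p` and `q` makes `r - p` smaller than the gap `q - p`. The
  -- threshold is 2 because shorter partial sums do not depend on the argument.
  exp-mono-< with r , p<r , r<q ← ℚ.<-dense p<q = ε′ , 0<ε , 2 , λ n 2≤n →
    subst (λ n → expSum p n ℚ.+ ε′ ℚ.< expSum q n) (m∸n+n≡m 2≤n) (gap (n ∸ 2))
    where
    ε′ : ℚ
    ε′ = r ℚ.- p
    0<ε : 0ℚ ℚ.< ε′
    0<ε = subst (ℚ._< ε′) (ℚ.+-inverseʳ p) (ℚ.+-monoˡ-< (ℚ.- p) p<r)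
    expSum-2 : ∀ x → expSum x 2 ≡ 1ℚ ℚ.+ x
    expSum-2 x = cong (1ℚ ℚ.+_) (trans (ℚ.*-identityˡ _) (ℚ.*-identityʳ x))
    cancel : ∀ x y → (1ℚ ℚ.+ x) ℚ.+ (y ℚ.- x) ≡ 1ℚ ℚ.+ y
    cancel = solve 2 (λ x y → (con 1ℚ :+ x) :+ (y :- x) := con 1ℚ :+ y) refl
      where open +-*-Solver
    exchange : ∀ x y z → (x ℚ.+ y) ℚ.+ z ≡ (x ℚ.+ z) ℚ.+ y
    exchange = solve 3 (λ x y z → (x :+ y) :+ z := (x :+ z) :+ y) refl
      where open +-*-Solver
    gap : ∀ j → expSum p (j + 2) ℚ.+ ε′ ℚ.< expSum q (j + 2)
    gap zero = begin-strict
      expSum p 2 ℚ.+ ε′      ≡⟨ cong (ℚ._+ ε′) (expSum-2 p) ⟩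
      (1ℚ ℚ.+ p) ℚ.+ ε′      ≡⟨ cancel p r ⟩
      1ℚ ℚ.+ r               <⟨ ℚ.+-monoʳ-< 1ℚ r<q ⟩
      1ℚ ℚ.+ q               ≡⟨ expSum-2 q ⟨
      expSum q 2             ∎
      where open ℚ.≤-Reasoning
    gap (suc j) = begin-strict
      (expSum p (j + 2) ℚ.+ expTerm p (j + 2)) ℚ.+ ε′
        ≡⟨ exchange (expSum p (j + 2)) (expTerm p (j + 2)) ε′ ⟩
      (expSum p (j + 2) ℚ.+ ε′) ℚ.+ expTerm p (j + 2)
        <⟨ ℚ.+-mono-<-≤ (gap j) (expTerm-mono (j + 2)) ⟩
      expSum q (j + 2) ℚ.+ expTerm q (j + 2) ∎
      where open ℚ.≤-Reasoning

/1-mono-< : ∀ {a b} → a < b → ℤ.+ a / 1 ℚ.< ℤ.+ b / 1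
/1-mono-< {a} {b} a<b = ℚ.toℚᵘ-cancel-< (begin-strict
  ℚ.toℚᵘ (ℤ.+ a / 1)    ≃⟨ ℚ.toℚᵘ-fromℚᵘ (ℚᵘ.mkℚᵘ (ℤ.+ a) 0) ⟩
  ℚᵘ.mkℚᵘ (ℤ.+ a) 0     <⟨ ℚᵘ.*<* (ℤ.*-monoʳ-<-pos (ℤ.+ 1) (ℤ.+<+ a<b)) ⟩
  ℚᵘ.mkℚᵘ (ℤ.+ b) 0     ≃⟨ ℚ.toℚᵘ-fromℚᵘ (ℚᵘ.mkℚᵘ (ℤ.+ b) 0) ⟨
  ℚ.toℚᵘ (ℤ.+ b / 1)    ∎)
  where open ℚᵘ.≤-Reasoning

e^-mono-< : ∀ a b → a < b → e^ a <ℝ e^ b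
e^-mono-< a b a<b = exp-mono-< (ℚ.nonNegative⁻¹ _ {{ℚ.normalize-nonNeg a 1}}) (/1-mono-< a<b)

-- Hyper-Zagreb indices

-- Naming the difference as a polynomial with natural coefficients reduces an inequality to an
-- identity for the ring solver.
by-slack : ∀ {x y} s → y ≡ x + s → x ≤ y
by-slack {x} s refl = m≤m+n x s

sq-sum : ℕ → ℕ → ℕ
sq-sum a b = (a + b) ^ 2

sq-prod : ℕ → ℕ → ℕ
sq-prod a b = (a * b) ^ 2

-- (s - 3)(s - 4) ≥ 0
sq-secant : ∀ s → 7 * s ≤ s ^ 2 + 12
sq-secant 0 = z≤n
sq-secant 1 = m≤m+n 7 6
sq-secant 2 = m≤m+n 14 2
sq-secant 3 = ≤-refl
sq-secant (suc (suc (suc (suc t)))) = by-slack (t + t * t) (eq t)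
  where
  eq : ∀ t → (4 + t) * ((4 + t) * 1) + 12 ≡ 7 * (4 + t) + (t + t * t)
  eq = solve-∀

-- `7 s - 12` is the secant of s² through s = 3 and s = 4, the degree sums on edges of types {1,2}
-- and {2,2}. With Δ = 3 + r there remain k = (Δ + 1)² + 5 and e = 2 Δ - 4, and `21 d - 14` is the
-- secant of 7 d².
estimate₁ : ∀ r → EdgeEstimate sq-sum (7 *_) (3 + r) 6 ((4 + r) * (4 + r) + 5) (2 + 2 * r) 15 14
estimate₁ r = record
  { F-comm    = λ a b → cong (_^ 2) (+-comm a b)
  ; g+g≤F     = λ s t → ≤-trans (≤-reflexive (sym (*-distribˡ-+ 7 (1 + s) (1 + t))))
                          (sq-secant ((1 + s) + (1 + t)))
  ; k+g≤F     = λ t → by-slack (t + 2 * r * t + t * t) (eq₁ r t)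
  ; k+e+g≤F   = λ t → by-slack (3 * t + 2 * r * t + t * t) (eq₂ r t)
  ; secant    = at-least
  ; secant-<  = more
  }
  where
  eq₁ : ∀ r t → (3 + r + (1 + t)) * ((3 + r + (1 + t)) * 1) + 12 ≡
                (4 + r) * (4 + r) + 5 + 7 * (1 + t) + (t + 2 * r * t + t * t)
  eq₁ = solve-∀
  eq₂ : ∀ r t → (3 + r + (2 + t)) * ((3 + r + (2 + t)) * 1) + 12 ≡
                (4 + r) * (4 + r) + 5 + (2 + 2 * r) + 7 * (2 + t) + (3 * t + 2 * r * t + t * t)
  eq₂ = solve-∀
  eq₃ : ∀ t → (2 + t) * (7 * (2 + t)) + 14 ≡ 21 * (2 + t) + (7 * t + 7 * (t * t))
  eq₃ = solve-∀
  eq₄ : ∀ t → (3 + t) * (7 * (3 + t)) + 14 ≡ 1 + 21 * (3 + t) + (13 + 21 * t + 7 * (t * t))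
  eq₄ = solve-∀
  at-least : ∀ d → 21 * d ≤ d * (7 * d) + 14
  at-least 0             = z≤n
  at-least 1             = ≤-refl
  at-least (suc (suc t)) = by-slack (7 * t + 7 * (t * t)) (eq₃ t)
  more : ∀ {d} → 3 ≤ d → 21 * d < d * (7 * d) + 14
  more (s≤s (s≤s (s≤s {n = t} _))) = by-slack (13 + 21 * t + 7 * (t * t)) (eq₄ t)

-- With g 1 = 0, the pair (1, d) allows exactly g d ≤ d² + 8.
g₂ : ℕ → ℕ
g₂ (suc (suc t)) = (2 + t) * (2 + t) + 8
g₂ _             = 0

-- Equality on the types {1,2} and {2,2} together with g 1 = 0 forces c = 4 and g 2 = 12. With Δ = 3
-- + r there remain k = Δ² + 8 and e = 3 Δ² - 12, and `24 d - 24` is the secant of d · g d.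
estimate₂ : ∀ r → EdgeEstimate sq-prod g₂ (3 + r) 4 ((3 + r) * (3 + r) + 8) (15 + 18 * r + 3 * (r * r)) 20 24
estimate₂ r = record
  { F-comm    = λ a b → cong (_^ 2) (*-comm a b)
  ; g+g≤F     = pair
  ; k+g≤F     = ≥1-elim (λ b → (3 + r) * (3 + r) + 8 + g₂ b ≤ sq-prod (3 + r) b + 8)
                  (≤-reflexive (eq₁ r))
                  (λ t → ≤-trans (+-monoˡ-≤ (g₂ (2 + t)) (m≤m+n ((3 + r) * (3 + r) + 8) _)) (hub t))
  ; k+e+g≤F   = hub
  ; secant    = at-least
  ; secant-<  = more
  }
  where
  ≥1-elim : (P : ℕ → Set) → P 1 → (∀ t → P (2 + t)) → ∀ t → P (1 + t)
  ≥1-elim P p₁ p₂ zero    = p₁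
  ≥1-elim P p₁ p₂ (suc t) = p₂ t
  eq₁ : ∀ r → (3 + r) * (3 + r) + 8 + 0 ≡ (3 + r) * 1 * ((3 + r) * 1 * 1) + 8
  eq₁ = solve-∀
  -- With Δ = 3 + r and b = 2 + t the last product is (Δ² - 1)(b² - 4).
  eq₂ : ∀ r t → (3 + r) * (2 + t) * ((3 + r) * (2 + t) * 1) + 8 ≡
                (3 + r) * (3 + r) + 8 + (15 + 18 * r + 3 * (r * r)) + ((2 + t) * (2 + t) + 8) +
                (8 + 6 * r + r * r) * (4 * t + t * t)
  eq₂ = solve-∀
  eq₃ : ∀ t → (3 + t) * ((3 + t) * (3 + t) + 8) + 24 ≡
              1 + 24 * (3 + t) + (2 + 11 * t + 9 * (t * t) + t * t * t)
  eq₃ = solve-∀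
  eq₄ : ∀ t → (2 + t) * (2 + t) + 8 ≡ 1 * (2 + t) * (1 * (2 + t) * 1) + 8
  eq₄ = solve-∀
  eq₅ : ∀ t → (2 + t) * (2 + t) + 8 + 0 ≡ (2 + t) * 1 * ((2 + t) * 1 * 1) + 8
  eq₅ = solve-∀
  -- With a = 2 + s and b = 2 + t the last summand is (a² - 1)(b² - 1) - 9, expanded around a = b =
  -- 2.
  eq₆ : ∀ s t → (2 + s) * (2 + t) * ((2 + s) * (2 + t) * 1) + 8 ≡
                (2 + s) * (2 + s) + 8 + ((2 + t) * (2 + t) + 8) +
                (3 * (4 * s + s * s) + 3 * (4 * t + t * t) + (4 * s + s * s) * (4 * t + t * t))
  eq₆ = solve-∀
  hub : ∀ t → (3 + r) * (3 + r) + 8 + (15 + 18 * r + 3 * (r * r)) + g₂ (2 + t) ≤ sq-prod (3 + r) (2 + t) + 8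
  hub t = by-slack ((8 + 6 * r + r * r) * (4 * t + t * t)) (eq₂ r t)
  at-least : ∀ d → 24 * d ≤ d * g₂ d + 24
  more : ∀ {d} → 3 ≤ d → 24 * d < d * g₂ d + 24
  more (s≤s (s≤s (s≤s {n = t} _))) = by-slack (2 + 11 * t + 9 * (t * t) + t * t * t) (eq₃ t)
  at-least 0                   = z≤n
  at-least 1                   = ≤-refl
  at-least 2                   = ≤-refl
  at-least (suc (suc (suc t))) = <⇒≤ (more (s≤s (s≤s (s≤s z≤n))))
  pair : ∀ s t → g₂ (1 + s) + g₂ (1 + t) ≤ sq-prod (1 + s) (1 + t) + 8
  pair = ≥1-elim (λ a → ∀ t → g₂ a + g₂ (1 + t) ≤ sq-prod a (1 + t) + 8)
    (≥1-elim (λ b → g₂ 1 + g₂ b ≤ sq-prod 1 b + 8) z≤n (λ t → ≤-reflexive (eq₄ t)))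
    (λ s → ≥1-elim (λ b → g₂ (2 + s) + g₂ b ≤ sq-prod (2 + s) b + 8)
      (≤-reflexive (eq₅ s)) (λ t → by-slack _ (eq₆ s t)))

-- Comparison with the broom

module _ {F : ℕ → ℕ → ℕ} {g : ℕ → ℕ} {m c k e α β : ℕ} (E : EdgeEstimate F g (suc m) c k e α β)
         (F-mono : ∀ {a b c d} → a ≤ b → c ≤ d → F a c ≤ F b d) where

  -- The two long hypotheses say that the star and the broom with a tail do not exceed the lower
  -- bound. The edge weights enter through `f₁`, `f₂`, `p`, `q`, so that both can be stated for
  -- plain polynomials.
  index-broom-< : ∀ {f₁ f₂ p q} → F (suc m) 1 ≤ f₁ → F (suc m) 2 ≤ f₂ → F 2 2 ≤ p → F 2 1 ≤ q →
    m * f₁ + f₁ + (β * (suc m + 0) + (α + c) * suc m) ≤ 2 * α * (suc m + 0) + suc m * k + e →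
    (∀ l → m * f₁ + f₂ + (l * p + q) + (β * (suc m + suc l) + (α + c) * suc m) ≤
           2 * α * (suc m + suc l) + suc m * k + e) →
    ∀ {l} (G : Graph (suc (suc m + l))) → Graph.Connected G → ∀ {ρ v} → degree G ρ ≡ suc m →
    v ≢ ρ → 3 ≤ degree G v → index F (Broom.tree m l) < index F G
  index-broom-< F₁ F₂ F₂₂ F₂₁ star≤ broom≤ {l} G conn ρ-hub v≢ρ 3≤v =
    +-cancelʳ-< (offset l) _ _ (≤-<-trans (upper l) (index-lowerBound E G conn ρ-hub v≢ρ 3≤v refl))
    where
    offset : ℕ → ℕ
    offset l = β * (suc m + l) + (α + c) * suc m
    upper : ∀ l → index F (Broom.tree m l) + offset l ≤ 2 * α * (suc m + l) + suc m * k + e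
    upper zero    = ≤-trans (+-monoˡ-≤ (offset 0) (≤-trans (index-star F F-mono m)
                      (+-mono-≤ (*-monoʳ-≤ m F₁) F₁))) star≤
    upper (suc l) = ≤-trans (+-monoˡ-≤ (offset (suc l)) (≤-trans (index-broom F F-mono m l)
                      (+-mono-≤ (+-mono-≤ (*-monoʳ-≤ m F₁) F₂) (+-mono-≤ (*-monoʳ-≤ l F₂₂) F₂₁)))) (broom≤ l)

square : ∀ x → x ^ 2 ≤ x * x
square x = ≤-reflexive (cong (x *_) (*-identityʳ x))

HM₁-broom-< : ∀ r {l} (G : Graph (suc (3 + r + l))) → Graph.Connected G → ∀ {ρ v} → degree G ρ ≡ 3 + r →
              v ≢ ρ → 3 ≤ degree G v → HM₁ (Broom.tree (2 + r) l) < HM₁ G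
HM₁-broom-< r = index-broom-< (estimate₁ r) mono
  (square (suc (2 + r) + 1)) (square (suc (2 + r) + 2)) (≤-refl {16}) (≤-refl {9})
  -- The slack is `e`: the centre of a star has no neighbour of degree 2. With a tail there is
  -- equality.
  (by-slack (2 + 2 * r) (star-eq r)) (λ l → ≤-reflexive (broom-eq r l))
  where
  mono : ∀ {a b c d} → a ≤ b → c ≤ d → sq-sum a c ≤ sq-sum b d
  mono a≤b c≤d = ^-monoˡ-≤ 2 (+-mono-≤ a≤b c≤d)
  star-eq : ∀ r → 2 * 15 * (suc (2 + r) + 0) + suc (2 + r) * ((4 + r) * (4 + r) + 5) + (2 + 2 * r) ≡
    (2 + r) * ((suc (2 + r) + 1) * (suc (2 + r) + 1)) + (suc (2 + r) + 1) * (suc (2 + r) + 1) +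
    (14 * (suc (2 + r) + 0) + (15 + 6) * suc (2 + r)) + (2 + 2 * r)
  star-eq = solve-∀
  broom-eq : ∀ r l →
    (2 + r) * ((suc (2 + r) + 1) * (suc (2 + r) + 1)) + (suc (2 + r) + 2) * (suc (2 + r) + 2) +
    (l * 16 + 9) + (14 * (suc (2 + r) + suc l) + (15 + 6) * suc (2 + r)) ≡
    2 * 15 * (suc (2 + r) + suc l) + suc (2 + r) * ((4 + r) * (4 + r) + 5) + (2 + 2 * r)
  broom-eq = solve-∀

HM₂-broom-< : ∀ r {l} (G : Graph (suc (3 + r + l))) → Graph.Connected G → ∀ {ρ v} → degree G ρ ≡ 3 + r →
              v ≢ ρ → 3 ≤ degree G v → HM₂ (Broom.tree (2 + r) l) < HM₂ G
HM₂-broom-< r = index-broom-< (estimate₂ r) mono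
  (square (suc (2 + r) * 1)) (square (suc (2 + r) * 2)) (≤-refl {16}) (≤-refl {4})
  (by-slack (15 + 18 * r + 3 * (r * r)) (star-eq r)) (λ l → ≤-reflexive (broom-eq r l))
  where
  mono : ∀ {a b c d} → a ≤ b → c ≤ d → sq-prod a c ≤ sq-prod b d
  mono a≤b c≤d = ^-monoˡ-≤ 2 (*-mono-≤ a≤b c≤d)
  star-eq : ∀ r →
    2 * 20 * (suc (2 + r) + 0) + suc (2 + r) * ((3 + r) * (3 + r) + 8) + (15 + 18 * r + 3 * (r * r)) ≡
    (2 + r) * (suc (2 + r) * 1 * (suc (2 + r) * 1)) + suc (2 + r) * 1 * (suc (2 + r) * 1) +
    (24 * (suc (2 + r) + 0) + (20 + 4) * suc (2 + r)) + (15 + 18 * r + 3 * (r * r))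
  star-eq = solve-∀
  broom-eq : ∀ r l →
    (2 + r) * (suc (2 + r) * 1 * (suc (2 + r) * 1)) + suc (2 + r) * 2 * (suc (2 + r) * 2) +
    (l * 16 + 4) + (24 * (suc (2 + r) + suc l) + (20 + 4) * suc (2 + r)) ≡
    2 * 20 * (suc (2 + r) + suc l) + suc (2 + r) * ((3 + r) * (3 + r) + 8) + (15 + 18 * r + 3 * (r * r))
  broom-eq = solve-∀

broom : ∀ r l → 𝒯 (suc (3 + r + l)) (3 + r)
broom r l = record
  { graph     = Broom.tree (2 + r) l
  ; isTree    = Broom.isTree (2 + r) l
  ; maxDegree = Broom.maxDegree (2 + r) l (s≤s z≤n)
  }

proposition3p4 : ∀ (n Δ : ℕ) (T : 𝒯 n Δ) (ρ : Fin n) →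
    degree (graph T) ρ ≡ Δ →
    (∃[ v ] (v ≢ ρ × 3 ≤ degree (graph T) v)) →
    Σ[ T′ ∈ 𝒯 n Δ ]
    (e^ (HM₁ (graph T)) >ℝ e^ (HM₁ (graph T′)) ×
    e^ (HM₂ (graph T)) >ℝ e^ (HM₂ (graph T′)))
proposition3p4 n Δ T ρ ρ-hub (v , v≢ρ , 3≤v) = compare T ρ-hub v≢ρ 3≤v
  -- From 3 ≤ deg v ≤ Δ comes `r` with Δ = 3 + r, and from deg ρ < n the tail length `l` with n = Δ
  -- + 1 + l.
  (m≤n⇒∃[o]m+o≡n (≤-trans 3≤v (MaxDegree.bounded (𝒯.maxDegree T) v)))
  (m≤n⇒∃[o]m+o≡n (subst (_< n) ρ-hub (degree<n (graph T) ρ)))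
  where
  compare : ∀ {n Δ} (T : 𝒯 n Δ) {ρ v : Fin n} → degree (graph T) ρ ≡ Δ → v ≢ ρ → 3 ≤ degree (graph T) v →
            ∃[ r ] 3 + r ≡ Δ → ∃[ l ] suc Δ + l ≡ n →
            Σ[ T′ ∈ 𝒯 n Δ ] (e^ (HM₁ (graph T)) >ℝ e^ (HM₁ (graph T′)) ×
                             e^ (HM₂ (graph T)) >ℝ e^ (HM₂ (graph T′)))
  compare T ρ-hub v≢ρ 3≤v (r , refl) (l , refl) =
      broom r l
    , e^-mono-< _ _ (HM₁-broom-< r (graph T) conn ρ-hub v≢ρ 3≤v)
    , e^-mono-< _ _ (HM₂-broom-< r (graph T) conn ρ-hub v≢ρ 3≤v)
    where
    conn : Graph.Connected (graph T)
    conn = IsTree.connected (𝒯.isTree T)
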